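{- If $H$ is a $k$-regular bipartite graph with bipartition $|X|=|Y|=n$, where $n=ak+b$ for some integers $0\le a,b$ with $b<k$, that is partitioned into $b$ connected components of size $k+1$ and $a-b$ connected components of size $k$, then $$\lim_{k\rightarrow\infty}\frac{\mathcal{M}(H)}{(k!)^{n/k}}=1.$$
   Context: Graphs are simple. A graph is $k$-regular if every vertex is incident to exactly $k$ edges. A bipartite graph with bipartition $X,Y$ has vertex set $X\cup Y$ (disjoint) and every edge joins a vertex of $X$ to a vertex of $Y$. A connected component has size $s$ if it has $s$ vertices in $X$ and $s$ vertices in $Y$; thus a component of size $k$ is the complete bipartite graph $K_{k,k}$, and a component of size $k+1$ is a connected $k$-regular bipartite graph with $k+1$ vertices on each side. A perfect matching of $H$ is a set of $n$ edges such that every vertex is incident to exactly one of them, and $\mathcal{M}(H)$ denotes the number of perfect matchings of $H$. -}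

module Defs where

open import Algebra.Bundles using (CommutativeRing)
import Algebra.Properties.Semiring.Exp as Exp
open import Data.Bool.Base using (true; false)
open import Data.Empty using (⊥)
open import Data.Fin.Base using (Fin)
import Data.Fin.Properties as Fin
open import Data.Fin.Subset using (Subset; _∈_; _⊆_; ∣_∣)
open import Data.Fin.Subset.Properties using (_⊆?_)
open import Data.Integer.Base using (+_)
open import Data.List.Base using (List; []; _∷_; allFin; filter; length; cartesianProductWith)
open import Data.Nat.Base as ℕ using (ℕ; zero; suc; NonZero; _!)
import Data.Nat.Properties as ℕ
open import Data.Product.Base using (∃; ∃-syntax; _×_; _,_)
open import Data.Rational.Base
  using (ℚ; 0ℚ; 1ℚ; _+_; _-_; _*_; _/_; 1/_; _<_; _≤_; positive; nonNegative)
open import Data.Rational.Properties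
open import Data.Sum.Base as Sum using (_⊎_; inj₁; inj₂)
open import Data.Sum.Properties using (≡-dec)
open import Data.Vec.Base as Vec using (Vec; lookup; transpose)
open import Function.Bundles using (_⇔_; mk⇔; Equivalence)
open import Relation.Binary.Construct.Closure.ReflexiveTransitive using (Star)
open import Relation.Binary.Definitions using (DecidableEquality; tri<; tri≈; tri>)
open import Relation.Binary.PropositionalEquality using (_≡_; refl; sym; trans; cong; subst; subst₂; module ≡-Reasoning)
open import Relation.Nullary using (¬_; Dec; yes; no; contradiction)
open import Relation.Nullary.Decidable using (_×-dec_)

-- X and Y are two disjoint copies of Fin n, and a set of X–Y edges is given
-- by the neighbourhood in Y of each x ∈ X.  A simple bipartite graph is its
-- set of edges.

EdgeSet : ℕ → Set
EdgeSet n = Vec (Subset n) n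

BipartiteGraph : ℕ → Set
BipartiteGraph = EdgeSet

Vertex : ℕ → Set
Vertex n = Fin n ⊎ Fin n

pattern inX x = inj₁ x
pattern inY y = inj₂ y

module _ {n : ℕ} where

  Adjacent : BipartiteGraph n → Vertex n → Vertex n → Set
  Adjacent H (inX x) (inY y)  = y ∈ lookup H x
  Adjacent H (inY y) (inX x)  = y ∈ lookup H x
  Adjacent H (inX _) (inX _)  = ⊥
  Adjacent H (inY _) (inY _)  = ⊥

  Connected : BipartiteGraph n → Vertex n → Vertex n → Set
  Connected H = Star (Adjacent H)

  degree : EdgeSet n → Vertex n → ℕ
  degree E (inX x) = ∣ lookup E x ∣
  degree E (inY y) = ∣ lookup (transpose E) y ∣

  edgeCount : EdgeSet n → ℕ
  edgeCount E = Vec.sum (Vec.map ∣_∣ E)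

Regular : ∀ {n} → ℕ → BipartiteGraph n → Set
Regular {n} k H = (v : Vertex n) → degree H v ≡ k

HasSize : ∀ {n} {C : Set} → DecidableEquality C → (Vertex n → C) → C → ℕ → Set
HasSize {n} _≟_ component c s =
  length (filter (λ x → component (inX x) ≟ c) (allFin n)) ≡ s ×
  length (filter (λ y → component (inY y) ≟ c) (allFin n)) ≡ s

-- H consists of p connected components of size s and q of size t.  For
-- positive s and t every label is attained, so the labels are in bijection with
-- the connected components.

record Components {n : ℕ} (H : BipartiteGraph n) (p s q t : ℕ) : Set where
  field
    component : Vertex n → Fin p ⊎ Fin q
    connected : ∀ u v → component u ≡ component v ⇔ Connected H u v
    size₁     : ∀ i → HasSize (≡-dec Fin._≟_ Fin._≟_) component (inj₁ i) s
    size₂     : ∀ j → HasSize (≡-dec Fin._≟_ Fin._≟_) component (inj₂ j) t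

IsPerfectMatching : ∀ {n} → BipartiteGraph n → EdgeSet n → Set
IsPerfectMatching {n} H M =
  (∀ x → lookup M x ⊆ lookup H x) ×
  edgeCount M ≡ n ×
  (∀ x → degree M (inX x) ≡ 1) ×
  (∀ y → degree M (inY y) ≡ 1)

isPerfectMatching? : ∀ {n} (H : BipartiteGraph n) (M : EdgeSet n) → Dec (IsPerfectMatching H M)
isPerfectMatching? {n} H M =
  Fin.all? (λ x → lookup M x ⊆? lookup H x) ×-dec
  (edgeCount M ℕ.≟ n) ×-dec
  Fin.all? (λ x → degree M (inX x) ℕ.≟ 1) ×-dec
  Fin.all? (λ y → degree M (inY y) ℕ.≟ 1)

allVecs : ∀ {A : Set} → List A → ∀ n → List (Vec A n)
allVecs xs zero    = Vec.[] ∷ []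
allVecs xs (suc n) = cartesianProductWith Vec._∷_ xs (allVecs xs n)

allEdgeSets : ∀ n → List (EdgeSet n)
allEdgeSets n = allVecs (allVecs (true ∷ false ∷ []) n) n

perfectMatchings : ∀ {n} → BipartiteGraph n → ℕ
perfectMatchings {n} H = length (filter (isPerfectMatching? H) (allEdgeSets n))

-- Two-sided Dedekind cuts of ℚ.

record ℝ : Set₁ where
  field
    lower upper   : ℚ → Set
    lower-inhabited : ∃ lower
    upper-inhabited : ∃ upper
    lower-rounded : ∀ q → lower q ⇔ (∃[ r ] q < r × lower r)
    upper-rounded : ∀ q → upper q ⇔ (∃[ r ] r < q × upper r)
    disjoint      : ∀ q → ¬ (lower q × upper q)
    located       : ∀ {q r} → q < r → lower q ⊎ upper r

open ℝ

∣_-_∣<_ : ℝ → ℚ → ℚ → Set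
∣ x - c ∣< ε = lower x (c - ε) × upper x (c + ε)

-- The real number sup A = inf B.

cut : (A B : ℚ → Set) → ∃ A → ∃ B →
      (∀ {a b} → A a → B b → a ≤ b) →
      (∀ {q r} → q < r → (∃[ a ] q < a × A a) ⊎ (∃[ b ] b < r × B b)) → ℝ
cut A B (a₀ , Aa₀) (b₀ , Bb₀) A≤B loc = record
  { lower           = λ q → ∃[ a ] q < a × A a
  ; upper           = λ q → ∃[ b ] b < q × B b
  ; lower-inhabited = a₀ - 1ℚ , a₀ , p-1<p a₀ , Aa₀
  ; upper-inhabited = b₀ + 1ℚ , b₀ , p<p+1 b₀ , Bb₀
  ; lower-rounded   = λ q → mk⇔
      (λ (a , q<a , Aa) → let (r , q<r , r<a) = <-dense q<a in r , q<r , a , r<a , Aa)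
      (λ (r , q<r , a , r<a , Aa) → a , <-trans q<r r<a , Aa)
  ; upper-rounded   = λ q → mk⇔
      (λ (b , b<q , Bb) → let (r , b<r , r<q) = <-dense b<q in r , r<q , b , b<r , Bb)
      (λ (r , r<q , b , b<r , Bb) → b , <-trans b<r r<q , Bb)
  ; disjoint        = λ q ((a , q<a , Aa) , (b , b<q , Bb)) →
      <-irrefl refl (<-≤-trans (<-trans b<q q<a) (A≤B Aa Bb))
  ; located         = loc
  }
  where
  p<p+1 : ∀ p → p < p + 1ℚ
  p<p+1 p = subst (_< p + 1ℚ) (+-identityʳ p) (+-monoʳ-< p (positive⁻¹ 1ℚ))

  p-1<p : ∀ p → p - 1ℚ < p
  p-1<p p = subst (p - 1ℚ <_) (+-identityʳ p) (+-monoʳ-< p (negative⁻¹ _))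

open Exp (CommutativeRing.semiring +-*-commutativeRing) using (_^_)

^-nonNeg : ∀ {p} → 0ℚ ≤ p → ∀ k → 0ℚ ≤ p ^ k
^-nonNeg 0≤p zero    = nonNegative⁻¹ 1ℚ
^-nonNeg {p} 0≤p (suc k) = nonNegative⁻¹ _
  {{nonNeg*nonNeg⇒nonNeg p {{nonNegative 0≤p}} (p ^ k) {{nonNegative (^-nonNeg 0≤p k)}}}}

^-mono-≤ : ∀ {p q} → 0ℚ ≤ p → p ≤ q → ∀ k → p ^ k ≤ q ^ k
^-mono-≤ 0≤p p≤q zero = ≤-refl
^-mono-≤ {p} {q} 0≤p p≤q (suc k) = ≤-trans
  (*-monoʳ-≤-nonNeg (p ^ k) {{nonNegative (^-nonNeg 0≤p k)}} p≤q)
  (*-monoˡ-≤-nonNeg q {{nonNegative (≤-trans 0≤p p≤q)}} (^-mono-≤ 0≤p p≤q k))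

^-mono-< : ∀ {p q} → 0ℚ ≤ p → p < q → ∀ k .{{_ : NonZero k}} → p ^ k < q ^ k
^-mono-< {p} {q} 0≤p p<q (suc zero) = subst₂ _<_ (sym (*-identityʳ p)) (sym (*-identityʳ q)) p<q
^-mono-< {p} {q} 0≤p p<q (suc k@(suc _)) = ≤-<-trans
  (*-monoʳ-≤-nonNeg (p ^ k) {{nonNegative (^-nonNeg 0≤p k)}} (<⇒≤ p<q))
  (*-monoʳ-<-pos q {{positive (≤-<-trans 0≤p p<q)}} (^-mono-< 0≤p p<q k))

^-≤ : ∀ {p} → 0ℚ ≤ p → p ≤ 1ℚ → ∀ k .{{_ : NonZero k}} → p ^ k ≤ p
^-≤ {p} 0≤p p≤1 (suc k) = subst (p ^ suc k ≤_) (*-identityʳ p)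
  (*-monoˡ-≤-nonNeg p {{nonNegative 0≤p}} (p^k≤1 k))
  where
  p^k≤1 : ∀ j → p ^ j ≤ 1ℚ
  p^k≤1 zero    = ≤-refl
  p^k≤1 (suc j) = ≤-trans
    (subst (p ^ suc j ≤_) (*-identityʳ p) (*-monoˡ-≤-nonNeg p {{nonNegative 0≤p}} (p^k≤1 j))) p≤1

≤-^ : ∀ {p} → 1ℚ ≤ p → ∀ k .{{_ : NonZero k}} → p ≤ p ^ k
≤-^ {p} 1≤p (suc k) = subst (_≤ p ^ suc k) (*-identityʳ p)
  (*-monoˡ-≤-nonNeg p {{nonNegative (≤-trans (nonNegative⁻¹ 1ℚ) 1≤p)}} (1≤p^ k))
  where
  1≤p^ : ∀ j → 1ℚ ≤ p ^ j
  1≤p^ zero    = ≤-refl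
  1≤p^ (suc j) = ≤-trans 1≤p (subst (_≤ p ^ suc j) (*-identityʳ p)
    (*-monoˡ-≤-nonNeg p {{nonNegative (≤-trans (nonNegative⁻¹ 1ℚ) 1≤p)}} (1≤p^ j)))

root : (k : ℕ) .{{_ : NonZero k}} (c : ℚ) → 0ℚ ≤ c → ℝ
root k c 0≤c = cut A B (0ℚ , A0) (c + 1ℚ , Bc+1) A≤B loc
  where
  A B : ℚ → Set
  A r = 0ℚ ≤ r × r ^ k ≤ c
  B r = 0ℚ ≤ r × c ≤ r ^ k

  A0 : A 0ℚ
  A0 = ≤-refl , ≤-trans (^-≤ ≤-refl (nonNegative⁻¹ 1ℚ) k) 0≤c

  Bc+1 : B (c + 1ℚ)
  Bc+1 = ≤-trans 0≤c c≤c+1 , ≤-trans c≤c+1 (≤-^ 1≤c+1 k)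
    where
    c≤c+1 : c ≤ c + 1ℚ
    c≤c+1 = subst (_≤ c + 1ℚ) (+-identityʳ c) (+-monoʳ-≤ c (nonNegative⁻¹ 1ℚ))
    1≤c+1 : 1ℚ ≤ c + 1ℚ
    1≤c+1 = subst (_≤ c + 1ℚ) (+-identityˡ 1ℚ) (+-monoˡ-≤ 1ℚ 0≤c)

  A≤B : ∀ {a b} → A a → B b → a ≤ b
  A≤B {a} {b} (_ , a^k≤c) (0≤b , c≤b^k) with b <? a
  ... | yes b<a = contradiction (<-≤-trans (^-mono-< 0≤b b<a k) (≤-trans a^k≤c c≤b^k)) (<-irrefl refl)
  ... | no  b≮a = ≮⇒≥ b≮a

  loc : ∀ {q r} → q < r → (∃[ a ] q < a × A a) ⊎ (∃[ b ] b < r × B b)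
  loc q<r with <-dense q<r
  ... | m , q<m , m<r with m <? 0ℚ
  ...   | yes m<0 = inj₁ (0ℚ , <-trans q<m m<0 , A0)
  ...   | no  m≮0 with ≤-total (m ^ k) c
  ...     | inj₁ m^k≤c = inj₁ (m , q<m , ≮⇒≥ m≮0 , m^k≤c)
  ...     | inj₂ c≤m^k = inj₂ (m , m<r , ≮⇒≥ m≮0 , c≤m^k)

root-positive : ∀ k .{{_ : NonZero k}} {c} (0<c : 0ℚ < c) → lower (root k c (<⇒≤ 0<c)) 0ℚ
root-positive k {c} 0<c with ≤-total c 1ℚ
... | inj₁ c≤1 = c , 0<c , <⇒≤ 0<c , ^-≤ (<⇒≤ 0<c) c≤1 k
... | inj₂ 1≤c = 1ℚ , positive⁻¹ 1ℚ , nonNegative⁻¹ 1ℚ , ≤-trans (^-≤ (nonNegative⁻¹ 1ℚ) ≤-refl k) 1≤c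

-- p / x for real x > 0.  Since p ≥ 0, r ≤ p / x as soon as r * u ≤ p for some
-- u > x, and p / x ≤ r as soon as p ≤ r * l for some 0 < l < x.

quotient : (p : ℚ) → 0ℚ ≤ p → (x : ℝ) → lower x 0ℚ → ℝ
quotient p 0≤p x 0<x = cut A B (0ℚ , A0) B-inhabited A≤B loc
  where
  A B : ℚ → Set
  A r = ∃[ u ] upper x u × r * u ≤ p
  B r = ∃[ l ] lower x l × 0ℚ < l × p ≤ r * l

  A0 : A 0ℚ
  A0 = let (u , x<u) = upper-inhabited x in u , x<u , subst (_≤ p) (sym (*-zeroˡ u)) 0≤p

  positive-lower : ∃[ l ] 0ℚ < l × lower x l
  positive-lower = Equivalence.to (lower-rounded x 0ℚ) 0<x

  divide : ∀ {d} → 0ℚ < d → ∃[ e ] e * d ≡ p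
  divide {d} 0<d = p * d⁻¹ , (begin
    p * d⁻¹ * d    ≡⟨ *-assoc p d⁻¹ d ⟩
    p * (d⁻¹ * d)  ≡⟨ cong (p *_) (*-inverseˡ d) ⟩
    p * 1ℚ         ≡⟨ *-identityʳ p ⟩
    p              ∎)
    where
    open ≡-Reasoning
    instance
      d≢0 = pos⇒nonZero d {{positive 0<d}}
    d⁻¹ = 1/ d

  B-inhabited : ∃ B
  B-inhabited =
    let (l , 0<l , l<x) = positive-lower
        (e , e*l≡p)     = divide 0<l
    in e , l , l<x , 0<l , ≤-reflexive (sym e*l≡p)

  lower<upper : ∀ {l u} → lower x l → upper x u → l < u
  lower<upper {l} {u} l<x x<u with l <? u
  ... | yes l<u = l<u
  ... | no  l≮u = contradiction (l<x , x<l) (disjoint x l)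
    where
    x<l : upper x l
    x<l with <-cmp u l
    ... | tri< u<l _ _ = Equivalence.from (upper-rounded x l) (u , u<l , x<u)
    ... | tri≈ _ u≡l _ = subst (upper x) u≡l x<u
    ... | tri> _ _ l<u = contradiction l<u l≮u

  A≤B : ∀ {a b} → A a → B b → a ≤ b
  A≤B {a} {b} (u , x<u , au≤p) (l , l<x , 0<l , p≤bl) =
    *-cancelʳ-≤-pos u {{positive 0<u}} (≤-trans (≤-trans au≤p p≤bl) bl≤bu)
    where
    l<u = lower<upper l<x x<u
    0<u = <-trans 0<l l<u
    0≤b : 0ℚ ≤ b
    0≤b = *-cancelʳ-≤-pos l {{positive 0<l}} (≤-trans (≤-reflexive (*-zeroˡ l)) (≤-trans 0≤p p≤bl))
    bl≤bu : b * l ≤ b * u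
    bl≤bu = *-monoˡ-≤-nonNeg b {{nonNegative 0≤b}} (<⇒≤ l<u)

  loc : ∀ {q r} → q < r → (∃[ a ] q < a × A a) ⊎ (∃[ b ] b < r × B b)
  loc {q} {r} q<r with <-dense q<r
  ... | m , q<m , m<r with 0ℚ <? m | 0ℚ <? p
  ...   | no 0≮m  | _       = inj₁ (0ℚ , <-≤-trans q<m (≮⇒≥ 0≮m) , A0)
  ...   | yes 0<m | no 0≮p  =
    let (l , 0<l , l<x) = positive-lower
        0<ml = positive⁻¹ (m * l) {{pos*pos⇒pos m {{positive 0<m}} l {{positive 0<l}}}}
    in inj₂ (m , m<r , l , l<x , 0<l , ≤-trans (≮⇒≥ 0≮p) (<⇒≤ 0<ml))
  ...   | yes 0<m | yes 0<p with <-dense m<r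
  ...     | m′ , m<m′ , m′<r with divide 0<m | divide (<-trans 0<m m<m′)
  ...       | t , tm≡p | s , sm′≡p = Sum.map
    (λ x<t → m , q<m , t , x<t , ≤-reflexive (trans (*-comm m t) tm≡p))
    (λ s<x → m′ , m′<r , s , s<x , 0<s , ≤-reflexive (trans (sym sm′≡p) (*-comm s m′)))
    (Sum.swap (located x s<t))
    where
    0<s : 0ℚ < s
    0<s = *-cancelʳ-<-nonNeg m′ {{nonNegative (<⇒≤ (<-trans 0<m m<m′))}}
            (subst₂ _<_ (sym (*-zeroˡ m′)) (sym sm′≡p) 0<p)
    s<t : s < t
    s<t = *-cancelʳ-<-nonNeg m {{nonNegative (<⇒≤ 0<m)}}
            (subst (s * m <_) (trans sm′≡p (sym tm≡p))
              (*-monoʳ-<-pos s {{positive 0<s}} m<m′))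

fromℕ : ℕ → ℚ
fromℕ m = + m / 1

0≤fromℕ : ∀ m → 0ℚ ≤ fromℕ m
0≤fromℕ m = nonNegative⁻¹ (fromℕ m) {{normalize-nonNeg m 1}}

0<fromℕ : ∀ m .{{_ : NonZero m}} → 0ℚ < fromℕ m
0<fromℕ m = positive⁻¹ (fromℕ m) {{normalize-pos m 1}}

-- m ^ (n / k), as the k-th root of m ^ n.

fractionalPower : (m n k : ℕ) .{{_ : NonZero m}} .{{_ : NonZero k}} → ℝ
fractionalPower m n k = root k (fromℕ (m ℕ.^ n)) (<⇒≤ (0<fromℕ (m ℕ.^ n) {{ℕ.m^n≢0 m n}}))

fractionalPower-positive : ∀ m n k .{{_ : NonZero m}} .{{_ : NonZero k}} →
                           lower (fractionalPower m n k) 0ℚ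
fractionalPower-positive m n k = root-positive k (0<fromℕ (m ℕ.^ n) {{ℕ.m^n≢0 m n}})

matchingRatio : ∀ {n} (k : ℕ) .{{_ : NonZero k}} → BipartiteGraph n → ℝ
matchingRatio {n} k H =
  quotient (fromℕ (perfectMatchings H)) (0≤fromℕ (perfectMatchings H))
    (fractionalPower (k !) n k) (fractionalPower-positive (k !) n k)
  where
  instance
    k!≢0 : NonZero (k !)
    k!≢0 = k ℕ.!≢0

-- A component of size k is K_{k,k}, with k ! perfect matchings, and one of size
-- k + 1 is K_{k+1,k+1} minus a perfect matching, with D perfect matchings, D
-- being the number of derangements of k + 1 points.  So the k-th power of the
-- ratio is (D^k / (k !)^(k + 1))^b, and D^k / (k !)^(k + 1) has to be squeezed
-- between (q/(q + 1))^k and ((q + 1)/q)^k for every q and all large k.  Without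
-- logarithms: with e k = (1 + 1/k)^k, both D / k ! and the k-th root of k ! are
-- k / e k up to factors tending to 1.

module Submission where

open import Defs
open import Algebra.Bundles using (CommutativeRing)
import Algebra.Properties.CommutativeMonoid.Sum as CommutativeMonoidSum
import Algebra.Properties.Semiring.Exp as Exp
import Algebra.Properties.Semiring.Sum as SemiringSum
open import Data.Bool.Base using (Bool; true; false; if_then_else_)
open import Data.Empty using (⊥)
open import Data.Fin.Base using (Fin; zero; suc; punchIn; join; splitAt; _↑ˡ_; _↑ʳ_)
import Data.Fin.Properties as Fin
open import Data.Fin.Subset using (Subset; ⊤; ⁅_⁆; ∣_∣; _-_; _∈_; _⊆_) renaming (⊥ to ∅)
open import Data.Fin.Subset.Properties using (_⊆?_; x∈⁅x⁆; x∈⁅y⁆⇒x≡y; ∣⁅x⁆∣≡1; p─⊥≡p)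
open import Data.Integer.Base as ℤ using (+≤+; +<+)
import Data.Integer.Properties as ℤ
open import Data.List.Base using (List; []; _∷_; _++_; length; filter; map; tabulate; cartesianProductWith)
open import Data.List.Properties using (length-++; filter-++; filter-≐; filter-none; filter-accept; map-++; map-∘)
import Data.List.Relation.Unary.All as All
open import Data.Nat
  using (ℕ; zero; suc; NonZero; _+_; _*_; _^_; _∸_; _≤_; _<_; _!; _≟_; _⊔_; z≤n; s≤s; >-nonZero; >-nonZero⁻¹)
open import Data.Nat.ListAction using (sum)
open import Data.Nat.ListAction.Properties using (sum-++)
open import Data.Nat.Properties hiding (_≟_)
open import Data.Nat.Tactic.RingSolver using (solve-∀)
open import Data.Product using (∃-syntax; _×_; _,_; proj₁; proj₂)
open import Data.Rational as ℚ using (ℚ; 0ℚ; 1ℚ; mkℚ)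
import Data.Rational.Properties as ℚ
open import Data.Rational.Unnormalised.Base as ℚᵘ using (mkℚᵘ; *≤*; *<*; *≡*)
import Data.Rational.Unnormalised.Properties as ℚᵘ
open import Data.Sum.Base using (_⊎_; inj₁; inj₂)
open import Data.Sum.Properties using (≡-dec)
open import Data.Vec.Base as Vec using (Vec; []; _∷_; lookup; transpose; replicate; _⊛_)
open import Data.Vec.Properties using (lookup-replicate; lookup-⊛; []=⇒lookup; lookup⇒[]=)
open import Function.Base using (_∘_; id; it)
open import Function.Bundles using (Equivalence)
open import Relation.Binary.Construct.Closure.ReflexiveTransitive as Star using (_◅_)
open import Relation.Binary.PropositionalEquality
  using (_≡_; _≢_; refl; sym; trans; cong; cong₂; subst; subst₂; module ≡-Reasoning)
open import Relation.Nullary using (does; yes; no; contradiction)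
open import Relation.Nullary.Decidable using (_×-dec_)
open import Relation.Unary using (Decidable)

open Exp (CommutativeRing.semiring ℚ.+-*-commutativeRing) using () renaming (_^_ to _^ℚ_)
open SemiringSum +-*-semiring
  using (∑-distrib-+; ∑-comm; sum-cong-≗; *-distribˡ-sum; *-distribʳ-sum; sum-syntax; sum-replicate-zero)
module Product = CommutativeMonoidSum *-1-commutativeMonoid
open Product using () renaming (sum to product)

-- Fractions, and quotients by roots

-- The matchings are counted without an isomorphism to a standard graph. Rows are removed one at a
-- time, each together with the column it is matched to, so the induction runs over a set U of free
-- columns. Of a partly used component only two numbers matter: r, its remaining rows (as many as
-- its free columns), and p, the non-edges left between them, which form a matching. This leads to
-- the family `avoiding n i`, which interpolates between factorials and derangement numbers; the
-- same interpolation yields the estimates of D, since each newly restricted point costs a factor of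
-- about 1 - 1/N.
--
-- The estimates of D / k ! and of k ! contain the same e k, which therefore cancels. All of them
-- are inequalities between natural numbers with denominators cleared; rationals enter only at the
-- passage to cuts. Since b is fixed while k grows, the b components of size k + 1 together cost at
-- most the b-th power of (q + 1)/q, and q is chosen in terms of b and ε.

frac : (p d : ℕ) .{{_ : NonZero d}} → ℚ
frac p d = ℤ.+ p ℚ./ d

toℚᵘ-frac : ∀ p d → ℚ.toℚᵘ (frac p (suc d)) ℚᵘ.≃ mkℚᵘ (ℤ.+ p) d
toℚᵘ-frac p d = ℚ.toℚᵘ-fromℚᵘ (mkℚᵘ (ℤ.+ p) d)

-- `ℚ` keeps fractions in lowest terms, so cross multiplication goes through the unnormalised
-- rationals, where it is the definition of the order.
frac-≤ : ∀ p d p′ d′ .{{_ : NonZero d}} .{{_ : NonZero d′}} → p * d′ ≤ p′ * d → frac p d ℚ.≤ frac p′ d′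
frac-≤ p (suc d) p′ (suc d′) le = ℚ.toℚᵘ-cancel-≤ (begin
  ℚ.toℚᵘ (frac p (suc d))     ≃⟨ toℚᵘ-frac p d ⟩
  mkℚᵘ (ℤ.+ p) d              ≤⟨ *≤* (subst₂ ℤ._≤_ (ℤ.pos-* p (suc d′)) (ℤ.pos-* p′ (suc d)) (+≤+ le)) ⟩
  mkℚᵘ (ℤ.+ p′) d′            ≃⟨ toℚᵘ-frac p′ d′ ⟨
  ℚ.toℚᵘ (frac p′ (suc d′))   ∎)
  where open ℚᵘ.≤-Reasoning

frac-< : ∀ p d p′ d′ .{{_ : NonZero d}} .{{_ : NonZero d′}} → p * d′ < p′ * d → frac p d ℚ.< frac p′ d′
frac-< p (suc d) p′ (suc d′) lt = ℚ.toℚᵘ-cancel-< (begin-strict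
  ℚ.toℚᵘ (frac p (suc d))     ≃⟨ toℚᵘ-frac p d ⟩
  mkℚᵘ (ℤ.+ p) d              <⟨ *<* (subst₂ ℤ._<_ (ℤ.pos-* p (suc d′)) (ℤ.pos-* p′ (suc d)) (+<+ lt)) ⟩
  mkℚᵘ (ℤ.+ p′) d′            ≃⟨ toℚᵘ-frac p′ d′ ⟨
  ℚ.toℚᵘ (frac p′ (suc d′))   ∎)
  where open ℚᵘ.≤-Reasoning

frac-≡ : ∀ p d p′ d′ .{{_ : NonZero d}} .{{_ : NonZero d′}} → p * d′ ≡ p′ * d → frac p d ≡ frac p′ d′
frac-≡ p d p′ d′ eq = ℚ.≤-antisym (frac-≤ p d p′ d′ (≤-reflexive eq)) (frac-≤ p′ d′ p d (≤-reflexive (sym eq)))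

frac-* : ∀ p d p′ d′ .{{_ : NonZero d}} .{{_ : NonZero d′}} →
         frac p d ℚ.* frac p′ d′ ≡ frac (p * p′) (d * d′) {{m*n≢0 d d′}}
frac-* p (suc d) p′ (suc d′) = ℚ.toℚᵘ-injective (begin-equality
  ℚ.toℚᵘ (frac p (suc d) ℚ.* frac p′ (suc d′))                ≃⟨ ℚ.toℚᵘ-homo-* (frac p (suc d)) (frac p′ (suc d′)) ⟩
  ℚ.toℚᵘ (frac p (suc d)) ℚᵘ.* ℚ.toℚᵘ (frac p′ (suc d′))      ≃⟨ ℚᵘ.*-cong (toℚᵘ-frac p d) (toℚᵘ-frac p′ d′) ⟩
  mkℚᵘ (ℤ.+ p) d ℚᵘ.* mkℚᵘ (ℤ.+ p′) d′                        ≡⟨ cong (λ i → mkℚᵘ i (d′ + d * suc d′)) (ℤ.pos-* p p′) ⟨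
  mkℚᵘ (ℤ.+ (p * p′)) (d′ + d * suc d′)                       ≃⟨ toℚᵘ-frac (p * p′) (d′ + d * suc d′) ⟨
  ℚ.toℚᵘ (frac (p * p′) (suc d * suc d′))                     ∎)
  where open ℚᵘ.≤-Reasoning

frac-+ : ∀ p p′ d .{{_ : NonZero d}} → frac p d ℚ.+ frac p′ d ≡ frac (p + p′) d
frac-+ p p′ (suc d) = ℚ.toℚᵘ-injective (begin-equality
  ℚ.toℚᵘ (frac p (suc d) ℚ.+ frac p′ (suc d))                 ≃⟨ ℚ.toℚᵘ-homo-+ (frac p (suc d)) (frac p′ (suc d)) ⟩
  ℚ.toℚᵘ (frac p (suc d)) ℚᵘ.+ ℚ.toℚᵘ (frac p′ (suc d))       ≃⟨ ℚᵘ.+-cong (toℚᵘ-frac p d) (toℚᵘ-frac p′ d) ⟩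
  mkℚᵘ (ℤ.+ p) d ℚᵘ.+ mkℚᵘ (ℤ.+ p′) d                         ≃⟨ *≡* common ⟩
  mkℚᵘ (ℤ.+ (p + p′)) d                                       ≃⟨ toℚᵘ-frac (p + p′) d ⟨
  ℚ.toℚᵘ (frac (p + p′) (suc d))                              ∎)
  where
  open ℚᵘ.≤-Reasoning
  s = suc d
  ring : ∀ p p′ s → (p * s + p′ * s) * s ≡ (p + p′) * (s * s)
  ring = solve-∀
  common : ((ℤ.+ p) ℤ.* (ℤ.+ s) ℤ.+ (ℤ.+ p′) ℤ.* (ℤ.+ s)) ℤ.* (ℤ.+ s) ≡ (ℤ.+ (p + p′)) ℤ.* (ℤ.+ (s * s))
  common = trans (cong (ℤ._* (ℤ.+ s)) (cong₂ ℤ._+_ (sym (ℤ.pos-* p s)) (sym (ℤ.pos-* p′ s))))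
    (trans (sym (ℤ.pos-* (p * s + p′ * s) s)) (trans (cong ℤ.+_ (ring p p′ s)) (ℤ.pos-* (p + p′) (s * s))))

frac-^ : ∀ p d k .{{_ : NonZero d}} → frac p d ^ℚ k ≡ frac (p ^ k) (d ^ k) {{m^n≢0 d k}}
frac-^ p d zero    = refl
frac-^ p d (suc k) = trans (cong (frac p d ℚ.*_) (frac-^ p d k)) (frac-* p d (p ^ k) (d ^ k))
  where
  instance
    dᵏ≢0 : NonZero (d ^ k)
    dᵏ≢0 = m^n≢0 d k

unit-fraction-below : ∀ ε → 0ℚ ℚ.< ε → ∃[ s ] frac 1 (suc s) ℚ.< ε
-- Here ε = (n + 1)/(d + 1), and 1/(d + 2) is strictly smaller.
unit-fraction-below (mkℚ (ℤ.+ suc n) d c) _ = suc d , ℚ.toℚᵘ-cancel-< (begin-strict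
  ℚ.toℚᵘ (frac 1 (2 + d))   ≃⟨ toℚᵘ-frac 1 (suc d) ⟩
  mkℚᵘ (ℤ.+ 1) (suc d)      <⟨ *<* (subst₂ ℤ._<_ (ℤ.pos-* 1 (suc d)) (ℤ.pos-* (suc n) (2 + d)) (+<+ less)) ⟩
  mkℚᵘ (ℤ.+ suc n) d          ∎)
  where
  open ℚᵘ.≤-Reasoning
  less : 1 * suc d < suc n * (2 + d)
  less = ≤-trans (s≤s (≤-reflexive (*-identityˡ (suc d)))) (m≤m+n (2 + d) (n * (2 + d)))
unit-fraction-below (mkℚ (ℤ.+ zero) d c) (ℚ.*<* (+<+ ()))
unit-fraction-below (mkℚ ℤ.-[1+ n ] d c) (ℚ.*<* ())

1-frac : ∀ s → 1ℚ ℚ.- frac 1 (suc s) ≡ frac s (suc s)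
1-frac s = begin
  1ℚ ℚ.- σ                        ≡⟨ cong (ℚ._- σ) (trans (frac-+ s 1 (suc s)) (frac-≡ (s + 1) (suc s) 1 1 (ring s))) ⟨
  frac s (suc s) ℚ.+ σ ℚ.- σ      ≡⟨ ℚ.+-assoc (frac s (suc s)) σ (ℚ.- σ) ⟩
  frac s (suc s) ℚ.+ (σ ℚ.- σ)    ≡⟨ cong (frac s (suc s) ℚ.+_) (ℚ.+-inverseʳ σ) ⟩
  frac s (suc s) ℚ.+ 0ℚ           ≡⟨ ℚ.+-identityʳ (frac s (suc s)) ⟩
  frac s (suc s)                  ∎
  where
  open ≡-Reasoning
  σ = frac 1 (suc s)
  ring : ∀ s → (s + 1) * 1 ≡ 1 * suc s
  ring = solve-∀

1+frac : ∀ s .{{_ : NonZero s}} → 1ℚ ℚ.+ frac 1 s ≡ frac (suc s) s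
1+frac s = trans (cong (ℚ._+ frac 1 s) (frac-≡ 1 1 s s (trans (*-identityˡ s) (sym (*-identityʳ s)))))
  (trans (frac-+ s 1 s) (cong (λ p → frac p s) (+-comm s 1)))

-- The quotient p / c^(1/k) lies strictly between s/(s+1) and (s+1)/s once
-- c^(1/k) lies between p Q/R and p R/Q for some R/Q < (s+1)/s.
quotient-root-near-one : ∀ k .{{_ : NonZero k}} p c .{{_ : NonZero p}} 0≤p 0≤c 0<root s Q R
  .{{_ : NonZero s}} .{{_ : NonZero Q}} .{{_ : NonZero R}} →
  s * R < suc s * Q → c * Q ^ k ≤ (R * p) ^ k → (Q * p) ^ k ≤ R ^ k * c →
  ∀ {ε} → frac 1 s ℚ.< ε → ∣ quotient (fromℕ p) 0≤p (root k (fromℕ c) 0≤c) 0<root - 1ℚ ∣< ε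
quotient-root-near-one k p c 0≤p 0≤c 0<root s Q R sR<Q c≤ ≤c {ε} 1/s<ε = below , above
  where
  ring₁ : ∀ p R s → p * R * s ≡ p * (s * R)
  ring₁ = solve-∀
  ring₂ : ∀ p Q s → p * (s * Q) ≡ p * s * Q
  ring₂ = solve-∀
  ring₃ : ∀ p s → s * (p * suc s) * 1 ≡ p * (suc s * s)
  ring₃ = solve-∀
  ring₄ : ∀ p s → p * (s * suc s) ≡ suc s * (p * s) * 1
  ring₄ = solve-∀
  ring₅ : ∀ p R s → p * s * R ≡ p * (s * R)
  ring₅ = solve-∀
  ring₆ : ∀ p Q s → p * (s * Q) ≡ p * Q * s
  ring₆ = solve-∀

  instance
    Qᵏ≢0 : NonZero (Q ^ k)
    Qᵏ≢0 = m^n≢0 Q k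
    Rᵏ≢0 : NonZero (R ^ k)
    Rᵏ≢0 = m^n≢0 R k
    ss≢0 : NonZero (suc s * s)
    ss≢0 = m*n≢0 (suc s) s
    ss′≢0 : NonZero (s * suc s)
    ss′≢0 = m*n≢0 s (suc s)

  0≤frac : ∀ m d .{{_ : NonZero d}} → 0ℚ ℚ.≤ frac m d
  0≤frac m d = frac-≤ 0 1 m d z≤n

  1/1+s<ε : frac 1 (suc s) ℚ.< ε
  1/1+s<ε = ℚ.≤-<-trans (frac-≤ 1 (suc s) 1 s (*-monoʳ-≤ 1 (n≤1+n s))) 1/s<ε

  -- The quotient cut asks for some u beyond the root with s/(s + 1) · u ≤ p. Taking u = p (s + 1)/s
  -- gives equality, and u exceeds p R/Q, which bounds the root from above. In `above`, l = p s/(s +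
  -- 1) plays the mirrored role, below p Q/R.
  below : ℝ.lower (quotient (fromℕ p) 0≤p (root k (fromℕ c) 0≤c) 0<root) (1ℚ ℚ.- ε)
  below = frac s (suc s) ,
    subst (1ℚ ℚ.- ε ℚ.<_) (1-frac s) (ℚ.+-monoʳ-< 1ℚ (ℚ.neg-antimono-< 1/1+s<ε)) ,
    frac (p * suc s) s ,
    (frac (p * R) Q ,
     frac-< (p * R) Q (p * suc s) s (subst₂ _<_ (sym (ring₁ p R s)) (ring₂ p Q (suc s)) (*-monoʳ-< p sR<Q)) ,
     0≤frac (p * R) Q ,
     subst (fromℕ c ℚ.≤_) (sym (frac-^ (p * R) Q k)) (frac-≤ c 1 ((p * R) ^ k) (Q ^ k)
       (subst (c * Q ^ k ≤_) (trans (cong (_^ k) (*-comm R p)) (sym (*-identityʳ _))) c≤))) ,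
    subst (ℚ._≤ fromℕ p) (sym (frac-* s (suc s) (p * suc s) s))
      (frac-≤ (s * (p * suc s)) (suc s * s) p 1 (≤-reflexive (ring₃ p s)))

  above : ℝ.upper (quotient (fromℕ p) 0≤p (root k (fromℕ c) 0≤c) 0<root) (1ℚ ℚ.+ ε)
  above = frac (suc s) s ,
    subst (ℚ._< 1ℚ ℚ.+ ε) (1+frac s) (ℚ.+-monoʳ-< 1ℚ 1/s<ε) ,
    frac (p * s) (suc s) ,
    (frac (p * Q) R ,
     frac-< (p * s) (suc s) (p * Q) R (subst₂ _<_ (sym (ring₅ p R s)) (ring₆ p Q (suc s)) (*-monoʳ-< p sR<Q)) ,
     0≤frac (p * Q) R ,
     subst (ℚ._≤ fromℕ c) (sym (frac-^ (p * Q) R k)) (frac-≤ ((p * Q) ^ k) (R ^ k) c 1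
       (subst₂ _≤_ (trans (cong (_^ k) (*-comm Q p)) (sym (*-identityʳ _))) (*-comm (R ^ k) c) ≤c))) ,
    frac-< 0 1 (p * s) (suc s) (subst (0 <_) (sym (*-identityʳ (p * s))) (>-nonZero⁻¹ (p * s) {{m*n≢0 p s}})) ,
    subst (fromℕ p ℚ.≤_) (sym (frac-* (suc s) s (p * s) (suc s)))
      (frac-≤ p 1 (suc s * (p * s)) (s * suc s) (≤-reflexive (ring₄ p s)))

matchingRatio-near-one : ∀ {n} k .{{_ : NonZero k}} (H : BipartiteGraph n) .{{_ : NonZero (perfectMatchings H)}}
  s Q R .{{_ : NonZero s}} .{{_ : NonZero Q}} .{{_ : NonZero R}} → s * R < suc s * Q →
  (k !) ^ n * Q ^ k ≤ (R * perfectMatchings H) ^ k → (Q * perfectMatchings H) ^ k ≤ R ^ k * (k !) ^ n →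
  ∀ {ε} → frac 1 s ℚ.< ε → ∣ matchingRatio k H - 1ℚ ∣< ε
matchingRatio-near-one {n} k H s Q R sR<Q lower upper 1/s<ε =
  quotient-root-near-one k (perfectMatchings H) ((k !) ^ n) (0≤fromℕ (perfectMatchings H))
    (ℚ.<⇒≤ (0<fromℕ ((k !) ^ n))) (fractionalPower-positive (k !) n k) s Q R sR<Q lower upper 1/s<ε
  where
  instance
    k!≢0 : NonZero (k !)
    k!≢0 = k !≢0
    k!ⁿ≢0 : NonZero ((k !) ^ n)
    k!ⁿ≢0 = m^n≢0 (k !) n

open ≤-Reasoning

-- Derangement numbers

-- avoiding n i counts the permutations of n + i points without a fixed point
-- among the first n.
avoiding : ℕ → ℕ → ℕ
avoiding zero          i = i !
avoiding (suc zero)    i = i * i !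
avoiding (suc (suc n)) i = suc n * avoiding n i + suc (n + i) * avoiding (suc n) i

-- A chosen unrestricted point is either moved or fixed, and deleting it when fixed leaves
-- `avoiding n i`. The proof uses the defining recursion instead, which at i = 0 is the classical
-- D(n + 2) = (n + 1)(D(n) + D(n + 1)).
avoiding-difference : ∀ n i → avoiding n (suc i) ≡ avoiding (suc n) i + avoiding n i
avoiding-difference zero i = +-comm (i !) (i * i !)
avoiding-difference (suc zero) i = ring i (i !)
  where
  ring : ∀ i x → suc i * (suc i * x) ≡ (1 * x + suc i * (i * x)) + i * x
  ring = solve-∀
avoiding-difference (suc (suc n)) i = begin-equality
  suc n * avoiding n (suc i) + suc (n + suc i) * avoiding (suc n) (suc i)
    ≡⟨ cong₂ (λ u v → suc n * u + suc (n + suc i) * v) (avoiding-difference n i) (avoiding-difference (suc n) i) ⟩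
  suc n * (a₁ + a₀) + suc (n + suc i) * (a₂ + a₁)
    ≡⟨ ring n i a₀ a₁ a₂ ⟩
  (suc (suc n) * a₁ + suc (suc n + i) * a₂) + (suc n * a₀ + suc (n + i) * a₁) ∎
  where
  a₀ = avoiding n i
  a₁ = avoiding (suc n) i
  a₂ = avoiding (suc (suc n)) i
  ring : ∀ n i a₀ a₁ a₂ → suc n * (a₁ + a₀) + suc (n + suc i) * (a₂ + a₁) ≡
         (suc (suc n) * a₁ + suc (suc n + i) * a₂) + (suc n * a₀ + suc (n + i) * a₁)
  ring = solve-∀

-- An unrestricted point goes either to one of the n + 1 restricted points, which lifts the
-- restriction on that point, or to one of the i + 1 unrestricted ones.
avoiding-expand : ∀ n i → avoiding (suc n) (suc i) ≡ suc n * avoiding n (suc i) + suc i * avoiding (suc n) i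
avoiding-expand n i = begin-equality
  avoiding (suc n) (suc i)       ≡⟨ avoiding-difference (suc n) i ⟩
  avoiding (suc (suc n)) i + a₁  ≡⟨ ring n i a₀ a₁ ⟩
  suc n * (a₁ + a₀) + suc i * a₁ ≡⟨ cong (λ u → suc n * u + suc i * a₁) (avoiding-difference n i) ⟨
  suc n * avoiding n (suc i) + suc i * a₁ ∎
  where
  a₀ = avoiding n i
  a₁ = avoiding (suc n) i
  ring : ∀ n i a₀ a₁ → (suc n * a₀ + suc (n + i) * a₁) + a₁ ≡ suc n * (a₁ + a₀) + suc i * a₁
  ring = solve-∀

avoiding-growth : ∀ n i → (n + i) * avoiding n i ≤ avoiding (suc n) i
avoiding-growth zero    i = ≤-refl
avoiding-growth (suc n) i = m≤n+m (suc (n + i) * avoiding (suc n) i) (suc n * avoiding n i)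

-- Restricting one more of N = n + i + 1 points costs at most the factor 1 - 1/N: the permutations
-- lost number `avoiding n i`, at most 1/(n + i) of those that stay.
avoiding-lower-step : ∀ n i → (n + i) * avoiding n (suc i) ≤ suc (n + i) * avoiding (suc n) i
avoiding-lower-step n i = begin
  s * avoiding n (suc i)       ≡⟨ cong (s *_) (avoiding-difference n i) ⟩
  s * (a₁ + a₀)                ≡⟨ *-distribˡ-+ s a₁ a₀ ⟩
  s * a₁ + s * a₀              ≤⟨ +-monoʳ-≤ (s * a₁) (avoiding-growth n i) ⟩
  s * a₁ + a₁                  ≡⟨ +-comm (s * a₁) a₁ ⟩
  suc s * a₁                   ∎
  where
  s = n + i
  a₀ = avoiding n i
  a₁ = avoiding (suc n) i

-- The factor is 1 - 1/(N + 2) with N = n + i + 1. For n = m + 1, let X be the new count; the old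
-- one is X + B, so the claim amounts to X ≤ (N + 1) B. As X = (m + 1) A + (m + 1 + i) B and N + 1 =
-- m + i + 3, this is (m + 1) A ≤ 2 B, which follows from (m + i) A ≤ B and m + 1 ≤ 2 (m + i).
avoiding-upper-step : ∀ n i → 2 ≤ n + i →
  (3 + (n + i)) * avoiding (suc n) i ≤ (2 + (n + i)) * avoiding n (suc i)
avoiding-upper-step zero i _ = begin
  (3 + i) * (i * i !)                     ≤⟨ m≤m+n _ (2 * i !) ⟩
  (3 + i) * (i * i !) + 2 * i !           ≡⟨ ring i (i !) ⟩
  (2 + i) * (suc i * i !)                 ∎
  where
  ring : ∀ i x → (3 + i) * (i * x) + 2 * x ≡ (2 + i) * (suc i * x)
  ring = solve-∀
avoiding-upper-step (suc m) i 2≤1+m+i = begin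
  (3 + (suc m + i)) * (suc m * A + suc (m + i) * B)
    ≡⟨ ring₁ m i A B ⟩
  R + suc m * A
    ≤⟨ +-monoʳ-≤ R small ⟩
  R + 2 * B
    ≡⟨ ring₂ m i A B ⟩
  (2 + (suc m + i)) * (suc m * A + suc (m + i) * B + B)
    ≡⟨ cong ((2 + (suc m + i)) *_) (avoiding-difference (suc m) i) ⟨
  (2 + (suc m + i)) * avoiding (suc m) (suc i) ∎
  where
  A = avoiding m i
  B = avoiding (suc m) i
  R = (2 + (suc m + i)) * (suc m * A) + (3 + (suc m + i)) * (suc (m + i) * B)

  suc≤double : suc m ≤ 2 * (m + i)
  suc≤double = begin
    suc m               ≤⟨ s≤s (m≤m+n m i) ⟩
    1 + (m + i)         ≤⟨ +-monoˡ-≤ (m + i) (≤-pred 2≤1+m+i) ⟩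
    (m + i) + (m + i)   ≡⟨ cong ((m + i) +_) (+-identityʳ (m + i)) ⟨
    2 * (m + i)         ∎

  small : suc m * A ≤ 2 * B
  small = begin
    suc m * A           ≤⟨ *-monoˡ-≤ A suc≤double ⟩
    2 * (m + i) * A     ≡⟨ *-assoc 2 (m + i) A ⟩
    2 * ((m + i) * A)   ≤⟨ *-monoʳ-≤ 2 (avoiding-growth m i) ⟩
    2 * B               ∎

  ring₁ : ∀ m i A B → (3 + (suc m + i)) * (suc m * A + suc (m + i) * B) ≡
          ((2 + (suc m + i)) * (suc m * A) + (3 + (suc m + i)) * (suc (m + i) * B)) + suc m * A
  ring₁ = solve-∀

  ring₂ : ∀ m i A B → ((2 + (suc m + i)) * (suc m * A) + (3 + (suc m + i)) * (suc (m + i) * B)) + 2 * B ≡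
          (2 + (suc m + i)) * (suc m * A + suc (m + i) * B + B)
  ring₂ = solve-∀

-- Telescoped over n with N = n + i fixed, the two step bounds compare the
-- probability avoiding n i / N ! with powers of 1 - 1/N and of 1 - 1/(N + 2).

avoiding-lower : ∀ K n i → n + i ≡ suc K → suc K ! * K ^ n ≤ suc K ^ n * avoiding n i
avoiding-lower K zero    i refl = ≤-reflexive (*-comm (suc K !) 1)
avoiding-lower K (suc n) i refl = begin
  suc K ! * (K * K ^ n)                       ≡⟨ swap (suc K !) K (K ^ n) ⟩
  K * (suc K ! * K ^ n)                       ≤⟨ *-monoʳ-≤ K (avoiding-lower K n (suc i) (+-suc n i)) ⟩
  K * (suc K ^ n * avoiding n (suc i))        ≡⟨ swap K (suc K ^ n) _ ⟩
  suc K ^ n * (K * avoiding n (suc i))        ≤⟨ *-monoʳ-≤ (suc K ^ n) (avoiding-lower-step n i) ⟩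
  suc K ^ n * (suc K * avoiding (suc n) i)    ≡⟨ swap′ (suc K ^ n) (suc K) _ ⟩
  suc K * suc K ^ n * avoiding (suc n) i      ∎
  where
  swap : ∀ x y z → x * (y * z) ≡ y * (x * z)
  swap = solve-∀
  swap′ : ∀ x y z → x * (y * z) ≡ y * x * z
  swap′ = solve-∀

avoiding-upper : ∀ K n i → n + i ≡ suc K → 2 ≤ K → (3 + K) ^ n * avoiding n i ≤ (2 + K) ^ n * suc K !
avoiding-upper K zero    i refl _   = ≤-refl
avoiding-upper K (suc n) i refl 2≤K = begin
  (3 + K) * (3 + K) ^ n * avoiding (suc n) i   ≡⟨ swap (3 + K) ((3 + K) ^ n) _ ⟩
  (3 + K) ^ n * ((3 + K) * avoiding (suc n) i) ≤⟨ *-monoʳ-≤ ((3 + K) ^ n) (avoiding-upper-step n i 2≤K) ⟩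
  (3 + K) ^ n * ((2 + K) * avoiding n (suc i)) ≡⟨ swap′ ((3 + K) ^ n) (2 + K) _ ⟩
  (2 + K) * ((3 + K) ^ n * avoiding n (suc i)) ≤⟨ *-monoʳ-≤ (2 + K) (avoiding-upper K n (suc i) (+-suc n i) 2≤K) ⟩
  (2 + K) * ((2 + K) ^ n * suc K !)            ≡⟨ *-assoc (2 + K) ((2 + K) ^ n) (suc K !) ⟨
  (2 + K) * (2 + K) ^ n * suc K !              ∎
  where
  swap : ∀ x y z → x * y * z ≡ y * (x * z)
  swap = solve-∀
  swap′ : ∀ x y z → x * (y * z) ≡ y * (x * z)
  swap′ = solve-∀

-- Bounds for (1 + 1/k)^k and k !

^-distribʳ-* : ∀ m n o → (m * n) ^ o ≡ m ^ o * n ^ o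
^-distribʳ-* m n zero    = refl
^-distribʳ-* m n (suc o) = begin-equality
  m * n * (m * n) ^ o         ≡⟨ cong (m * n *_) (^-distribʳ-* m n o) ⟩
  m * n * (m ^ o * n ^ o)     ≡⟨ [m*n]*[o*p]≡[m*o]*[n*p] m n (m ^ o) (n ^ o) ⟩
  m * m ^ o * (n * n ^ o)     ∎

^-square : ∀ m o → (m * m) ^ o ≡ m ^ o * m ^ o
^-square m o = ^-distribʳ-* m m o

-- (1 - 1/(1+y))^j ≥ 1 - j/(1+y)
bernoulli-lower : ∀ y j → suc y ^ j * suc y ≤ y ^ j * suc y + j * suc y ^ j
bernoulli-lower y zero    = m≤m+n (1 * suc y) 0
bernoulli-lower y (suc j) = begin
  suc y * Z * suc y                          ≡⟨ ring₁ y Z ⟩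
  y * (Z * suc y) + suc y * Z                ≤⟨ +-monoˡ-≤ (suc y * Z) (*-monoʳ-≤ y (bernoulli-lower y j)) ⟩
  y * (Y * suc y + j * Z) + suc y * Z        ≤⟨ m≤m+n _ (j * Z) ⟩
  y * (Y * suc y + j * Z) + suc y * Z + j * Z  ≡⟨ ring₂ y j Y Z ⟩
  y * Y * suc y + suc j * (suc y * Z)        ∎
  where
  Y = y ^ j
  Z = suc y ^ j
  ring₁ : ∀ y Z → suc y * Z * suc y ≡ y * (Z * suc y) + suc y * Z
  ring₁ = solve-∀
  ring₂ : ∀ y j Y Z → y * (Y * suc y + j * Z) + suc y * Z + j * Z ≡ y * Y * suc y + suc j * (suc y * Z)
  ring₂ = solve-∀

-- (1 + 1/y)^j ≥ 1 + j/y
bernoulli-upper : ∀ y j → y ^ j * (y + j) ≤ suc y ^ j * y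
bernoulli-upper y zero    = ≤-reflexive (cong (1 *_) (+-identityʳ y))
bernoulli-upper y (suc j) = begin
  y * Y * (y + suc j)                ≤⟨ m≤m+n _ (j * Y) ⟩
  y * Y * (y + suc j) + j * Y        ≡⟨ ring y j Y ⟩
  suc y * (Y * (y + j))              ≤⟨ *-monoʳ-≤ (suc y) (bernoulli-upper y j) ⟩
  suc y * (suc y ^ j * y)            ≡⟨ *-assoc (suc y) (suc y ^ j) y ⟨
  suc y * suc y ^ j * y              ∎
  where
  Y = y ^ j
  ring : ∀ y j Y → y * Y * (y + suc j) + j * Y ≡ suc y * (Y * (y + j))
  ring = solve-∀

-- Writing e k = (1 + 1/k)^k, the quotient e (k + 1) / e k is
-- (s²-1 k / s² k)^k (k + 2)/(k + 1), where s = k + 1.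

private
  s²-1 s² : ℕ → ℕ
  s²-1 k = k * (2 + k)
  s² k = suc k * suc k

  s²≡1+s²-1 : ∀ k → s² k ≡ suc (s²-1 k)
  s²≡1+s²-1 = ring
    where
    ring : ∀ k → suc k * suc k ≡ suc (k * (2 + k))
    ring = solve-∀

  s²-1-^ : ∀ k j → s²-1 k ^ j ≡ k ^ j * (2 + k) ^ j
  s²-1-^ k j = ^-distribʳ-* k (2 + k) j

  s²-^ : ∀ k j → s² k ^ j ≡ suc k ^ j * suc k ^ j
  s²-^ k j = ^-square (suc k) j

-- Bernoulli gives (1 - 1/s²)^k ≥ 1 - k/s², and (s² - k)(s + 1) = s³ + 1 exceeds s³.
quotient-lower : ∀ k → s² k ^ k * suc k ≤ s²-1 k ^ k * (2 + k)
quotient-lower k = *-cancelʳ-≤ _ _ (s² k) (+-cancelʳ-≤ (k * Z * (2 + k)) _ _ (begin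
  Z * suc k * s² k + k * Z * (2 + k)          ≤⟨ m≤m+n _ Z ⟩
  Z * suc k * s² k + k * Z * (2 + k) + Z      ≡⟨ ring₁ k Z ⟩
  Z * s² k * (2 + k)                          ≤⟨ *-monoˡ-≤ (2 + k) bernoulli ⟩
  (Y * s² k + k * Z) * (2 + k)                ≡⟨ ring₂ k Y Z ⟩
  Y * (2 + k) * s² k + k * Z * (2 + k)        ∎))
  where
  Y = s²-1 k ^ k
  Z = s² k ^ k
  bernoulli : Z * s² k ≤ Y * s² k + k * Z
  bernoulli = subst (λ u → u ^ k * u ≤ Y * u + k * u ^ k) (sym (s²≡1+s²-1 k)) (bernoulli-lower (s²-1 k) k)
  ring₁ : ∀ k Z → Z * suc k * (suc k * suc k) + k * Z * (2 + k) + Z ≡ Z * (suc k * suc k) * (2 + k)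
  ring₁ = solve-∀
  ring₂ : ∀ k Y Z → (Y * (suc k * suc k) + k * Z) * (2 + k) ≡ Y * (2 + k) * (suc k * suc k) + k * Z * (2 + k)
  ring₂ = solve-∀

-- Bernoulli gives (s²/(s² - 1))^s ≥ 1 + s/(s² - 1), and (s² - 1 + s) s exceeds (s + 1)(s² - 1) by
-- 1.
quotient-upper : ∀ k .{{_ : NonZero k}} → s²-1 k ^ suc k * (2 + k) ≤ s² k ^ suc k * suc k
quotient-upper k@(suc _) = *-cancelʳ-≤ _ _ (s²-1 k) (begin
  Y * (2 + k) * s²-1 k            ≡⟨ *-assoc Y (2 + k) (s²-1 k) ⟩
  Y * ((2 + k) * s²-1 k)          ≤⟨ *-monoʳ-≤ Y (≤-trans (m≤m+n _ 1) (≤-reflexive (ring₁ k))) ⟩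
  Y * ((s²-1 k + suc k) * suc k)  ≡⟨ *-assoc Y (s²-1 k + suc k) (suc k) ⟨
  Y * (s²-1 k + suc k) * suc k    ≤⟨ *-monoˡ-≤ (suc k) bernoulli ⟩
  Z * s²-1 k * suc k              ≡⟨ ring₂ Z (s²-1 k) (suc k) ⟩
  Z * suc k * s²-1 k              ∎)
  where
  Y = s²-1 k ^ suc k
  Z = s² k ^ suc k
  bernoulli : Y * (s²-1 k + suc k) ≤ Z * s²-1 k
  bernoulli = subst (λ u → Y * (s²-1 k + suc k) ≤ u ^ suc k * s²-1 k) (sym (s²≡1+s²-1 k)) (bernoulli-upper (s²-1 k) (suc k))
  ring₁ : ∀ k → (2 + k) * (k * (2 + k)) + 1 ≡ (k * (2 + k) + suc k) * suc k
  ring₁ = solve-∀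
  ring₂ : ∀ u v w → u * v * w ≡ u * w * v
  ring₂ = solve-∀

-- This is e k ≤ e (k + 1) with denominators cleared.
euler-increasing : ∀ k → suc k ^ k * suc k ^ suc k ≤ k ^ k * (2 + k) ^ suc k
euler-increasing k = begin
  A * (suc k * A)              ≡⟨ ring₁ A (suc k) ⟩
  A * A * suc k                ≡⟨ cong (_* suc k) (s²-^ k k) ⟨
  s² k ^ k * suc k              ≤⟨ quotient-lower k ⟩
  s²-1 k ^ k * (2 + k)            ≡⟨ cong (_* (2 + k)) (s²-1-^ k k) ⟩
  B * (2 + k) ^ k * (2 + k)    ≡⟨ ring₂ B ((2 + k) ^ k) (2 + k) ⟩
  B * ((2 + k) * (2 + k) ^ k)  ∎
  where
  A = suc k ^ k
  B = k ^ k
  ring₁ : ∀ u v → u * (v * u) ≡ u * u * v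
  ring₁ = solve-∀
  ring₂ : ∀ u v w → u * v * w ≡ u * (w * v)
  ring₂ = solve-∀

-- The sequence (1 + 1/k)^(k+1) decreases.
euler-decreasing : ∀ k .{{_ : NonZero k}} →
  s²-1 k * ((2 + k) ^ suc k * k ^ k) ≤ s² k * (suc k ^ k * suc k ^ suc k)
euler-decreasing k = begin
  k * (2 + k) * ((2 + k) * C * B)    ≡⟨ ring₁ k B C ⟩
  k * (2 + k) * (B * C) * (2 + k)    ≡⟨ cong (λ u → s²-1 k * u * (2 + k)) (s²-1-^ k k) ⟨
  s²-1 k ^ suc k * (2 + k)              ≤⟨ quotient-upper k ⟩
  s² k ^ suc k * suc k                ≡⟨ cong (λ u → s² k * u * suc k) (s²-^ k k) ⟩
  s² k * (A * A) * suc k              ≡⟨ ring₂ (s² k) A (suc k) ⟩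
  s² k * (A * (suc k * A))            ∎
  where
  A = suc k ^ k
  B = k ^ k
  C = (2 + k) ^ k
  ring₁ : ∀ k B C → k * (2 + k) * ((2 + k) * C * B) ≡ k * (2 + k) * (B * C) * (2 + k)
  ring₁ = solve-∀
  ring₂ : ∀ u v w → u * (v * v) * w ≡ u * (v * (w * v))
  ring₂ = solve-∀

-- By `euler-decreasing`, e (k + 1) / e k is at most s²/(s² - 1). The k-th power of that is at most
-- (k + 2)/(k + 1) by `quotient-lower`, hence at most (k + 1)/k.
euler-quotient-power : ∀ k .{{_ : NonZero k}} →
  k * ((2 + k) ^ suc k * k ^ k) ^ k ≤ suc k * (suc k ^ k * suc k ^ suc k) ^ k
euler-quotient-power k@(suc _) = *-cancelˡ-≤ (s²-1 k ^ k) {{m^n≢0 (s²-1 k) k}} (begin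
  Y * (k * P ^ k)        ≡⟨ ring₁ Y k (P ^ k) ⟩
  k * (Y * P ^ k)        ≡⟨ cong (k *_) (^-distribʳ-* (s²-1 k) P k) ⟨
  k * (s²-1 k * P) ^ k      ≤⟨ *-monoʳ-≤ k (^-monoˡ-≤ k (euler-decreasing k)) ⟩
  k * (s² k * Q) ^ k      ≡⟨ cong (k *_) (^-distribʳ-* (s² k) Q k) ⟩
  k * (Z * Q ^ k)        ≡⟨ *-assoc k Z (Q ^ k) ⟨
  k * Z * Q ^ k          ≤⟨ *-monoˡ-≤ (Q ^ k) kZ≤ ⟩
  suc k * Y * Q ^ k      ≡⟨ ring₂ (suc k) Y (Q ^ k) ⟩
  Y * (suc k * Q ^ k)    ∎)
  where
  P = (2 + k) ^ suc k * k ^ k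
  Q = suc k ^ k * suc k ^ suc k
  Y = s²-1 k ^ k
  Z = s² k ^ k
  ring₁ : ∀ u v w → u * (v * w) ≡ v * (u * w)
  ring₁ = solve-∀
  ring₂ : ∀ u v w → u * v * w ≡ v * (u * w)
  ring₂ = solve-∀
  ring₃ : ∀ k Z → k * Z * suc k ≡ k * (Z * suc k)
  ring₃ = solve-∀
  ring₄ : ∀ k Y → k * (Y * (2 + k)) + Y ≡ suc k * Y * suc k
  ring₄ = solve-∀
  kZ≤ : k * Z ≤ suc k * Y
  kZ≤ = *-cancelʳ-≤ _ _ (suc k) (begin
    k * Z * suc k              ≡⟨ ring₃ k Z ⟩
    k * (Z * suc k)            ≤⟨ *-monoʳ-≤ k (quotient-lower k) ⟩
    k * (Y * (2 + k))          ≤⟨ m≤m+n _ Y ⟩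
    k * (Y * (2 + k)) + Y      ≡⟨ ring₄ k Y ⟩
    suc k * Y * suc k          ∎)

-- The crude bound e k ≤ k + 1 costs only a polynomial factor. The induction keeps the base fixed:
-- (1 + 1/k)^j ≤ j + 1 as long as j ≤ k.
euler-bound : ∀ k .{{_ : NonZero k}} → suc k ^ k ≤ suc k * k ^ k
euler-bound k@(suc _) = begin
  suc k ^ k              ≤⟨ bound k ≤-refl ⟩
  suc k * k ^ k          ∎
  where
  ring₁ : ∀ k j K → suc k * (suc j * K) ≡ (k * suc j + suc j) * K
  ring₁ = solve-∀
  ring₂ : ∀ k j K → (k * suc j + k) * K ≡ suc (suc j) * (k * K)
  ring₂ = solve-∀
  bound : ∀ j → j ≤ k → suc k ^ j ≤ suc j * k ^ j
  bound zero    _   = ≤-refl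
  bound (suc j) j<k = begin
    suc k * suc k ^ j              ≤⟨ *-monoʳ-≤ (suc k) (bound j (<⇒≤ j<k)) ⟩
    suc k * (suc j * k ^ j)        ≡⟨ ring₁ k j (k ^ j) ⟩
    (k * suc j + suc j) * k ^ j    ≤⟨ *-monoˡ-≤ (k ^ j) (+-monoʳ-≤ (k * suc j) j<k) ⟩
    (k * suc j + k) * k ^ j        ≡⟨ ring₂ k j (k ^ j) ⟩
    suc (suc j) * (k * k ^ j)      ∎

-- k ! lies between (k / e k)^k and k (k + 1) (k / e k)^k.

factorial-lower : ∀ k → (k ^ k) ^ suc k ≤ (suc k ^ k) ^ k * k !
factorial-lower zero    = ≤-refl
factorial-lower (suc k) = *-cancelʳ-≤ _ _ (A ^ suc k) {{m^n≢0 A (suc k) {{m^n≢0 (suc k) k}}}} (begin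
  B′ * B′ ^ suc k * A ^ suc k              ≡⟨ *-assoc B′ (B′ ^ suc k) (A ^ suc k) ⟩
  B′ * (B′ ^ suc k * A ^ suc k)            ≡⟨ cong (B′ *_) (trans (*-comm (B′ ^ suc k) (A ^ suc k)) (sym (^-distribʳ-* A B′ (suc k)))) ⟩
  -- Here e k replaces e (k + 1). The remaining steps match exactly, because ((k + 1)/k)^k is e k
  -- itself.
  B′ * (A * B′) ^ suc k                    ≤⟨ *-monoʳ-≤ B′ (^-monoˡ-≤ (suc k) (euler-increasing k)) ⟩
  B′ * (B * A′) ^ suc k                    ≡⟨ cong (B′ *_) (^-distribʳ-* B A′ (suc k)) ⟩
  B′ * (B ^ suc k * A′ ^ suc k)            ≤⟨ *-monoʳ-≤ B′ (*-monoˡ-≤ (A′ ^ suc k) (factorial-lower k)) ⟩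
  B′ * (A ^ k * k ! * A′ ^ suc k)          ≡⟨ ring (suc k) A (A ^ k) (k !) (A′ ^ suc k) ⟩
  A′ ^ suc k * (suc k * k !) * A ^ suc k   ∎)
  where
  A  = suc k ^ k
  B  = k ^ k
  A′ = (2 + k) ^ suc k
  B′ = suc k ^ suc k
  ring : ∀ s A Aᵏ F A′ → s * A * (Aᵏ * F * A′) ≡ A′ * (s * F) * (A * Aᵏ)
  ring = solve-∀

-- With k = j + 1 this is k ! ≤ k · k^k / (e k)^(k - 1). The exponent k - 1 lets the induction
-- close: in the step, (e (k + 1) / e k)^k ≤ (k + 1)/k is absorbed by the prefactor k, and the one
-- additional e k turns k^k into (k + 1)^k.
factorial-upper-sharp : ∀ j → suc j ! * (suc (suc j) ^ suc j) ^ j ≤ suc j * (suc j ^ suc j) ^ suc j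
factorial-upper-sharp zero    = ≤-refl
factorial-upper-sharp (suc j) = *-cancelʳ-≤ _ _ (k * B ^ k) {{m*n≢0 k (B ^ k) {{_}} {{m^n≢0 B k {{m^n≢0 k k}}}}}} (begin
  suc k * k ! * A′ ^ k * (k * B ^ k)          ≡⟨ ring₁ (suc k * k !) (A′ ^ k) k (B ^ k) ⟩
  suc k * k ! * (k * (A′ ^ k * B ^ k))        ≡⟨ cong (λ u → suc k * k ! * (k * u)) (^-distribʳ-* A′ B k) ⟨
  suc k * k ! * (k * (A′ * B) ^ k)            ≤⟨ *-monoʳ-≤ (suc k * k !) (euler-quotient-power k) ⟩
  suc k * k ! * (suc k * (A * B′) ^ k)        ≡⟨ cong (λ u → suc k * k ! * (suc k * u)) (^-distribʳ-* A B′ k) ⟩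
  suc k * k ! * (suc k * (A * A ^ j * B′ ^ k))  ≡⟨ ring₂ (suc k) (k !) A (A ^ j) (B′ ^ k) ⟩
  suc k * suc k * A * B′ ^ k * (k ! * A ^ j)    ≤⟨ *-monoʳ-≤ (suc k * suc k * A * B′ ^ k) (factorial-upper-sharp j) ⟩
  suc k * suc k * A * B′ ^ k * (k * B ^ k)      ≡⟨ cong (_* (k * B ^ k)) (ring₃ (suc k) A (B′ ^ k)) ⟩
  suc k * (suc k * A * B′ ^ k) * (k * B ^ k)    ∎)
  where
  k  = suc j
  A  = suc k ^ k
  B  = k ^ k
  A′ = (2 + k) ^ suc k
  B′ = suc k ^ suc k
  ring₁ : ∀ u v w x → u * v * (w * x) ≡ u * (w * (v * x))
  ring₁ = solve-∀
  ring₂ : ∀ s F A Aʲ B′ → s * F * (s * (A * Aʲ * B′)) ≡ s * s * A * B′ * (F * Aʲ)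
  ring₂ = solve-∀
  ring₃ : ∀ s A B′ → s * s * A * B′ ≡ s * (s * A * B′)
  ring₃ = solve-∀

factorial-upper : ∀ k .{{_ : NonZero k}} → k ! * (suc k ^ k) ^ k ≤ k * suc k * (k ^ k) ^ suc k
factorial-upper k@(suc j) = begin
  k ! * (A * A ^ j)            ≡⟨ ring₁ (k !) A (A ^ j) ⟩
  A * (k ! * A ^ j)            ≤⟨ *-mono-≤ (euler-bound k) (factorial-upper-sharp j) ⟩
  suc k * B * (k * B ^ k)      ≡⟨ ring₂ (suc k) B k (B ^ k) ⟩
  k * suc k * (B * B ^ k)      ∎
  where
  A = suc k ^ k
  B = k ^ k
  ring₁ : ∀ u v w → u * (v * w) ≡ v * (u * w)
  ring₁ = solve-∀
  ring₂ : ∀ s B k Bᵏ → s * B * (k * Bᵏ) ≡ k * s * (B * Bᵏ)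
  ring₂ = solve-∀

-- Derangement numbers against factorials

derangements : ℕ → ℕ
derangements n = avoiding n 0

-- D / k ! ≥ k / e k, from `avoiding-lower` with all k + 1 points restricted.
derangements-lower : ∀ k → k ! * (k * k ^ k) ≤ derangements (suc k) * suc k ^ k
derangements-lower k = *-cancelˡ-≤ (suc k) (begin
  suc k * (k ! * (k * k ^ k))              ≡⟨ *-assoc (suc k) (k !) _ ⟨
  suc k ! * k ^ suc k                      ≤⟨ avoiding-lower k (suc k) 0 (+-identityʳ (suc k)) ⟩
  suc k * suc k ^ k * D                    ≡⟨ ring (suc k) (suc k ^ k) D ⟩
  suc k * (D * suc k ^ k)                  ∎)
  where
  D = derangements (suc k)
  ring : ∀ u v w → u * v * w ≡ u * (w * v)
  ring = solve-∀

-- `avoiding-upper` gives D ≤ (k + 1) ! · (k + 3)/(k + 2) / e (k + 2). Then (k + 1)(k + 3) ≤ (k +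
-- 2)² and e k ≤ e (k + 2) turn this into D / k ! ≤ (k + 2) / e k.
derangements-upper : ∀ k → 2 ≤ k → derangements (suc k) * suc k ^ k ≤ (2 + k) * (k ! * k ^ k)
derangements-upper k 2≤k = *-cancelˡ-≤ ((3 + k) ^ suc k * (3 + k)) {{m*n≢0 _ _ {{m^n≢0 (3 + k) (suc k)}}}} (begin
  C * (3 + k) * (D * A)                  ≡⟨ ring₁ C (3 + k) D A ⟩
  C * D * ((3 + k) * A)                  ≤⟨ *-monoˡ-≤ ((3 + k) * A) (avoiding-upper k (suc k) 0 (+-identityʳ (suc k)) 2≤k) ⟩
  A′ * (suc k * F) * ((3 + k) * A)       ≡⟨ ring₂ k A′ F A ⟩
  suc k * (3 + k) * (F * (A * A′))       ≤⟨ *-monoˡ-≤ (F * (A * A′)) square ⟩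
  (2 + k) * (2 + k) * (F * (A * A′))     ≡⟨ ring₃ (2 + k) F A A′ ⟩
  (2 + k) * F * (A * ((2 + k) * A′))     ≤⟨ *-monoʳ-≤ ((2 + k) * F) increasing₂ ⟩
  (2 + k) * F * (B * ((3 + k) * C))      ≡⟨ ring₄ (2 + k) F B (3 + k) C ⟩
  C * (3 + k) * ((2 + k) * (F * B))      ∎)
  where
  F  = k !
  D  = derangements (suc k)
  A  = suc k ^ k
  B  = k ^ k
  A′ = (2 + k) ^ suc k
  B′ = suc k ^ suc k
  C  = (3 + k) ^ suc k
  square : suc k * (3 + k) ≤ (2 + k) * (2 + k)
  square = ≤-trans (n≤1+n _) (≤-reflexive (ring k))
    where
    ring : ∀ k → suc (suc k * (3 + k)) ≡ (2 + k) * (2 + k)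
    ring = solve-∀
  ring₁ : ∀ C t D A → C * t * (D * A) ≡ C * D * (t * A)
  ring₁ = solve-∀
  ring₂ : ∀ k A′ F A → A′ * (suc k * F) * ((3 + k) * A) ≡ suc k * (3 + k) * (F * (A * A′))
  ring₂ = solve-∀
  ring₃ : ∀ s F A A′ → s * s * (F * (A * A′)) ≡ s * F * (A * (s * A′))
  ring₃ = solve-∀
  ring₄ : ∀ s F B t C → s * F * (B * (t * C)) ≡ C * t * (s * (F * B))
  ring₄ = solve-∀
  increasing₂ : A * (2 + k) ^ (2 + k) ≤ B * (3 + k) ^ (2 + k)
  increasing₂ = *-cancelʳ-≤ _ _ (B′ * A′) {{m*n≢0 _ _ {{m^n≢0 (suc k) (suc k)}} {{m^n≢0 (2 + k) (suc k)}}}} (begin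
    A * (2 + k) ^ (2 + k) * (B′ * A′)      ≡⟨ ring₆ A ((2 + k) ^ (2 + k)) B′ A′ ⟩
    A * B′ * (A′ * (2 + k) ^ (2 + k))      ≤⟨ *-mono-≤ (euler-increasing k) (euler-increasing (suc k)) ⟩
    B * A′ * (B′ * (3 + k) ^ (2 + k))      ≡⟨ ring₇ B A′ B′ ((3 + k) ^ (2 + k)) ⟩
    B * (3 + k) ^ (2 + k) * (B′ * A′)      ∎)
    where
    ring₆ : ∀ u v w x → u * v * (w * x) ≡ u * w * (x * v)
    ring₆ = solve-∀
    ring₇ : ∀ u v w x → u * v * (w * x) ≡ u * x * (w * v)
    ring₇ = solve-∀

-- Polynomial factors are absorbed by a geometric one: 1 + 1/q ≥ (1 + 1/m)³ for
-- m = 3 (q + 1), and (1 + 1/m)^k ≥ k/m.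
geometric-absorbs : ∀ q → ∃[ K ] ∀ k → K ≤ k → k * suc k * q ^ k ≤ suc q ^ k
geometric-absorbs q = 2 * m³ , absorb
  where
  m  = 3 * suc q
  m³ = m * m * m

  cube : q * (suc m * suc m * suc m) ≤ suc q * m³
  cube = ≤-trans (m≤m+n _ (18 * q * q + 44 * q + 27)) (≤-reflexive (ring q))
    where
    ring : ∀ q → q * (suc (3 * suc q) * suc (3 * suc q) * suc (3 * suc q)) + (18 * q * q + 44 * q + 27) ≡
           suc q * (3 * suc q * (3 * suc q) * (3 * suc q))
    ring = solve-∀

  cube^ : ∀ u k → (u * u * u) ^ k ≡ u ^ k * u ^ k * u ^ k
  cube^ u k = trans (^-distribʳ-* (u * u) u k) (cong (_* u ^ k) (^-square u k))

  absorb : ∀ k → 2 * m³ ≤ k → k * suc k * q ^ k ≤ suc q ^ k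
  absorb zero      _     = z≤n
  absorb k@(suc _) 2m³≤k = *-cancelʳ-≤ _ _ (m³ * (V * V * V)) {{m*n≢0 m³ _ {{_}} {{V³≢0}}}} (begin
    k * suc k * Q * (m³ * (V * V * V))     ≡⟨ ring₁ k Q m³ V ⟩
    -- Three Bernoulli factors k/m supply k³/m³, and k ≥ 2 m³ makes this at least k (k + 1).
    suc k * m³ * (k * Q * (V * V * V))     ≤⟨ *-monoˡ-≤ (k * Q * (V * V * V)) large ⟩
    k * k * (k * Q * (V * V * V))          ≡⟨ ring₂ k Q V ⟩
    Q * (V * k * (V * k) * (V * k))        ≤⟨ *-monoʳ-≤ Q (*-mono-≤ (*-mono-≤ bernoulli bernoulli) bernoulli) ⟩
    Q * (W * m * (W * m) * (W * m))        ≡⟨ ring₃ Q W m ⟩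
    Q * (W * W * W) * m³                   ≤⟨ *-monoˡ-≤ m³ cubeᵏ ⟩
    suc q ^ k * (V * V * V) * m³           ≡⟨ ring₄ (suc q ^ k) (V * V * V) m³ ⟩
    suc q ^ k * (m³ * (V * V * V))         ∎)
    where
    Q = q ^ k
    V = m ^ k
    W = suc m ^ k
    V≢0 : NonZero V
    V≢0 = m^n≢0 m k
    V³≢0 : NonZero (V * V * V)
    V³≢0 = m*n≢0 (V * V) V {{m*n≢0 V V {{V≢0}} {{V≢0}}}} {{V≢0}}
    bernoulli : V * k ≤ W * m
    bernoulli = ≤-trans (*-monoʳ-≤ V (m≤n+m k m)) (bernoulli-upper m k)
    cubeᵏ : Q * (W * W * W) ≤ suc q ^ k * (V * V * V)
    cubeᵏ = begin
      Q * (W * W * W)                      ≡⟨ cong (Q *_) (cube^ (suc m) k) ⟨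
      Q * (suc m * suc m * suc m) ^ k      ≡⟨ ^-distribʳ-* q _ k ⟨
      (q * (suc m * suc m * suc m)) ^ k    ≤⟨ ^-monoˡ-≤ k cube ⟩
      (suc q * m³) ^ k                     ≡⟨ ^-distribʳ-* (suc q) m³ k ⟩
      suc q ^ k * m³ ^ k                   ≡⟨ cong (suc q ^ k *_) (cube^ m k) ⟩
      suc q ^ k * (V * V * V)              ∎
    large : suc k * m³ ≤ k * k
    large = begin
      suc k * m³          ≤⟨ *-monoˡ-≤ m³ (+-monoˡ-≤ k {1} {k} (s≤s z≤n)) ⟩
      (k + k) * m³        ≡⟨ ring₅ k m³ ⟩
      k * (2 * m³)        ≤⟨ *-monoʳ-≤ k 2m³≤k ⟩
      k * k               ∎
      where
      ring₅ : ∀ k c → (k + k) * c ≡ k * (2 * c)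
      ring₅ = solve-∀
    ring₁ : ∀ k Q c V → k * suc k * Q * (c * (V * V * V)) ≡ suc k * c * (k * Q * (V * V * V))
    ring₁ = solve-∀
    ring₂ : ∀ k Q V → k * k * (k * Q * (V * V * V)) ≡ Q * (V * k * (V * k) * (V * k))
    ring₂ = solve-∀
    ring₃ : ∀ Q W m → Q * (W * m * (W * m) * (W * m)) ≡ Q * (W * W * W) * (m * m * m)
    ring₃ = solve-∀
    ring₄ : ∀ u v w → u * v * w ≡ u * (w * v)
    ring₄ = solve-∀

-- Both D / k ! and the k-th root of k ! are compared with k / e k. The lower estimate loses the
-- factor k (k + 1) from `factorial-upper`, which `geometric-absorbs` pays for; the upper one loses
-- (k + 2)/k in each of k factors, at most (q + 1)/q once k ≥ 2 q.
derangement-asymptotics : ∀ q → ∃[ K ] ∀ k .{{_ : NonZero k}} → K ≤ k →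
  ((k !) ^ suc k * q ^ k ≤ (suc q * derangements (suc k)) ^ k) ×
  ((q * derangements (suc k)) ^ k ≤ suc q ^ k * (k !) ^ suc k)
derangement-asymptotics q with K₁ , absorb ← geometric-absorbs q =
  K₁ ⊔ (2 ⊔ 2 * q) , λ k K≤k →
    lower k (absorb k (≤-trans (m≤m⊔n K₁ (2 ⊔ 2 * q)) K≤k)) ,
    upper k (≤-trans (≤-trans (m≤m⊔n 2 (2 * q)) (m≤n⊔m K₁ _)) K≤k)
            (≤-trans (≤-trans (m≤n⊔m 2 (2 * q)) (m≤n⊔m K₁ _)) K≤k)
  where
  A≢0 : ∀ k → NonZero ((suc k ^ k) ^ k)
  A≢0 k = m^n≢0 (suc k ^ k) k {{m^n≢0 (suc k) k}}

  lower : ∀ k .{{_ : NonZero k}} → k * suc k * q ^ k ≤ suc q ^ k →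
          (k !) ^ suc k * q ^ k ≤ (suc q * derangements (suc k)) ^ k
  lower k absorbed = *-cancelʳ-≤ _ _ (A ^ k) {{A≢0 k}} (begin
    F * F ^ k * q ^ k * A ^ k                ≡⟨ ring₁ F (F ^ k) (q ^ k) (A ^ k) ⟩
    F ^ k * q ^ k * (F * A ^ k)              ≤⟨ *-monoʳ-≤ (F ^ k * q ^ k) (factorial-upper k) ⟩
    F ^ k * q ^ k * (k * suc k * (B * B ^ k))  ≡⟨ ring₂ (F ^ k) (q ^ k) (k * suc k) B (B ^ k) ⟩
    k * suc k * q ^ k * (F ^ k * (B * B ^ k))  ≤⟨ *-mono-≤ absorbed FkB≤DA ⟩
    suc q ^ k * (D ^ k * A ^ k)              ≡⟨ *-assoc (suc q ^ k) (D ^ k) (A ^ k) ⟨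
    suc q ^ k * D ^ k * A ^ k                ≡⟨ cong (_* A ^ k) (^-distribʳ-* (suc q) D k) ⟨
    (suc q * D) ^ k * A ^ k                  ∎)
    where
    F = k !
    D = derangements (suc k)
    A = suc k ^ k
    B = k ^ k
    FkB≤DA : F ^ k * (B * B ^ k) ≤ D ^ k * A ^ k
    FkB≤DA = begin
      F ^ k * (B * B ^ k)        ≡⟨ cong (F ^ k *_) (^-distribʳ-* k B k) ⟨
      F ^ k * (k * B) ^ k        ≡⟨ ^-distribʳ-* F (k * B) k ⟨
      (F * (k * B)) ^ k          ≤⟨ ^-monoˡ-≤ k (derangements-lower k) ⟩
      (D * A) ^ k                ≡⟨ ^-distribʳ-* D A k ⟩
      D ^ k * A ^ k              ∎
    ring₁ : ∀ F G Q C → F * G * Q * C ≡ G * Q * (F * C)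
    ring₁ = solve-∀
    ring₂ : ∀ G Q s B C → G * Q * (s * (B * C)) ≡ s * Q * (G * (B * C))
    ring₂ = solve-∀

  upper : ∀ k → 2 ≤ k → 2 * q ≤ k → (q * derangements (suc k)) ^ k ≤ suc q ^ k * (k !) ^ suc k
  upper k 2≤k 2q≤k = *-cancelʳ-≤ _ _ (A ^ k) {{A≢0 k}} (begin
    (q * D) ^ k * A ^ k                    ≡⟨ ^-distribʳ-* (q * D) A k ⟨
    (q * D * A) ^ k                        ≤⟨ ^-monoˡ-≤ k qDA≤ ⟩
    (suc q * F * (k * B)) ^ k              ≡⟨ ^-distribʳ-* (suc q * F) (k * B) k ⟩
    (suc q * F) ^ k * (k * B) ^ k          ≡⟨ cong₂ _*_ (^-distribʳ-* (suc q) F k) (^-distribʳ-* k B k) ⟩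
    suc q ^ k * F ^ k * (B * B ^ k)        ≤⟨ *-monoʳ-≤ (suc q ^ k * F ^ k) (factorial-lower k) ⟩
    suc q ^ k * F ^ k * (A ^ k * F)        ≡⟨ ring₁ (suc q ^ k) (F ^ k) (A ^ k) F ⟩
    suc q ^ k * (F * F ^ k) * A ^ k        ∎)
    where
    F = k !
    D = derangements (suc k)
    A = suc k ^ k
    B = k ^ k
    ring₁ : ∀ Q G C F → Q * G * (C * F) ≡ Q * (F * G) * C
    ring₁ = solve-∀
    ring₂ : ∀ q k u → q * ((2 + k) * u) ≡ (2 * q + q * k) * u
    ring₂ = solve-∀
    ring₃ : ∀ q k F B → (k + q * k) * (F * B) ≡ suc q * F * (k * B)
    ring₃ = solve-∀
    qDA≤ : q * D * A ≤ suc q * F * (k * B)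
    qDA≤ = begin
      q * D * A                ≡⟨ *-assoc q D A ⟩
      q * (D * A)              ≤⟨ *-monoʳ-≤ q (derangements-upper k 2≤k) ⟩
      q * ((2 + k) * (F * B))  ≡⟨ ring₂ q k (F * B) ⟩
      (2 * q + q * k) * (F * B)  ≤⟨ *-monoˡ-≤ (F * B) (+-monoˡ-≤ (q * k) 2q≤k) ⟩
      (k + q * k) * (F * B)    ≡⟨ ring₃ q k F B ⟩
      suc q * F * (k * B)      ∎

-- Counting perfect matchings row by row

module _ {A B C : Set} {P : C → Set} (P? : Decidable P) where

  length-filter-map : ∀ (f : B → C) ys → length (filter P? (map f ys)) ≡ length (filter (P? ∘ f) ys)
  length-filter-map f []       = refl
  length-filter-map f (y ∷ ys) with does (P? (f y))
  ... | true  = cong suc (length-filter-map f ys)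
  ... | false = length-filter-map f ys

  length-filter-cartesianProductWith : ∀ (f : A → B → C) xs ys →
    length (filter P? (cartesianProductWith f xs ys)) ≡ sum (map (λ x → length (filter (P? ∘ f x) ys)) xs)
  length-filter-cartesianProductWith f []       ys = refl
  length-filter-cartesianProductWith f (x ∷ xs) ys = begin-equality
    length (filter P? (map (f x) ys ++ rest))
      ≡⟨ cong length (filter-++ P? (map (f x) ys) rest) ⟩
    length (filter P? (map (f x) ys) ++ filter P? rest)
      ≡⟨ length-++ (filter P? (map (f x) ys)) ⟩
    length (filter P? (map (f x) ys)) + length (filter P? rest)
      ≡⟨ cong₂ _+_ (length-filter-map (f x) ys) (length-filter-cartesianProductWith f xs ys) ⟩
    length (filter (P? ∘ f x) ys) + sum (map (λ x → length (filter (P? ∘ f x) ys)) xs) ∎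
    where
    rest = cartesianProductWith f xs ys

indicator : Bool → ℕ
indicator b = if b then 1 else 0

member : ∀ {n} → Subset n → Fin n → ℕ
member p y = indicator (lookup p y)

bits : List Bool
bits = true ∷ false ∷ []

sum-subsets-split : ∀ {n} (G : Subset (suc n) → ℕ) →
  sum (map G (allVecs bits (suc n))) ≡
  sum (map (λ v → G (true ∷ v)) (allVecs bits n)) + sum (map (λ v → G (false ∷ v)) (allVecs bits n))
sum-subsets-split {n} G = begin-equality
  sum (map G (map (true ∷_) L ++ (map (false ∷_) L ++ [])))
    ≡⟨ sum-map-++ (map (true ∷_) L) ⟩
  sum (map G (map (true ∷_) L)) + sum (map G (map (false ∷_) L ++ []))
    ≡⟨ cong₂ _+_ (cong sum (sym (map-∘ L))) (sum-map-++ (map (false ∷_) L)) ⟩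
  sum (map (λ v → G (true ∷ v)) L) + (sum (map G (map (false ∷_) L)) + 0)
    ≡⟨ cong (sum (map (λ v → G (true ∷ v)) L) +_) (trans (+-identityʳ _) (cong sum (sym (map-∘ L)))) ⟩
  sum (map (λ v → G (true ∷ v)) L) + sum (map (λ v → G (false ∷ v)) L) ∎
  where
  L = allVecs bits n
  sum-map-++ : ∀ xs {ys} → sum (map G (xs ++ ys)) ≡ sum (map G xs) + sum (map G ys)
  sum-map-++ xs {ys} = trans (cong sum (map-++ G xs ys)) (sum-++ (map G xs) (map G ys))

sum-empty-subsets : ∀ n (G : Subset n → ℕ) → (∀ v → ∣ v ∣ ≢ 0 → G v ≡ 0) →
                    sum (map G (allVecs bits n)) ≡ G ∅
sum-empty-subsets zero    G supp = +-identityʳ (G [])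
sum-empty-subsets (suc n) G supp = begin-equality
  sum (map G (allVecs bits (suc n)))   ≡⟨ sum-subsets-split G ⟩
  _                                    ≡⟨ cong₂ _+_ (sum-empty-subsets n (G ∘ (true ∷_)) (λ v _ → supp (true ∷ v) λ ()))
                                                   (sum-empty-subsets n (G ∘ (false ∷_)) (λ v → supp (false ∷ v))) ⟩
  G (true ∷ ∅) + G (false ∷ ∅)         ≡⟨ cong (_+ G (false ∷ ∅)) (supp (true ∷ ∅) λ ()) ⟩
  G (false ∷ ∅)                        ∎

-- Every row of a matching is a singleton, so this turns a sum over all candidate rows into a sum
-- over columns.
sum-singleton-subsets : ∀ n (G : Subset n → ℕ) → (∀ v → ∣ v ∣ ≢ 1 → G v ≡ 0) →
                        sum (map G (allVecs bits n)) ≡ ∑[ y < n ] G ⁅ y ⁆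
sum-singleton-subsets zero    G supp = trans (+-identityʳ (G [])) (supp [] λ ())
sum-singleton-subsets (suc n) G supp = trans (sum-subsets-split G) (cong₂ _+_
  (sum-empty-subsets n (G ∘ (true ∷_)) (λ v ∣v∣≢0 → supp (true ∷ v) (∣v∣≢0 ∘ suc-injective)))
  (sum-singleton-subsets n (G ∘ (false ∷_)) (λ v → supp (false ∷ v))))

member-remove : ∀ {n} (U : Subset n) y z → lookup U y ≡ true → member ⁅ y ⁆ z + member (U - y) z ≡ member U z
member-remove (true ∷ U) zero    zero    refl = refl
member-remove (b ∷ U)    zero    (suc z) _    = cong₂ _+_ (cong indicator (lookup-replicate z false)) (cong (λ p → member p z) (p─⊥≡p U))
member-remove (true ∷ U)  (suc y) zero    _    = refl
member-remove (false ∷ U) (suc y) zero    _    = refl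
member-remove (b ∷ U)    (suc y) (suc z) eq   = member-remove U y z eq

size-∷ : ∀ {n} b (p : Subset n) → ∣ b ∷ p ∣ ≡ indicator b + ∣ p ∣
size-∷ true  p = refl
size-∷ false p = refl

size-sum : ∀ {n} (p : Subset n) → ∣ p ∣ ≡ ∑[ y < n ] member p y
size-sum []      = refl
size-sum (b ∷ p) = trans (size-∷ b p) (cong (indicator b +_) (size-sum p))

column-∷ : ∀ {m n} (v : Subset n) (M : Vec (Subset n) m) y →
           lookup (transpose (v ∷ M)) y ≡ lookup v y ∷ lookup (transpose M) y
column-∷ {m} {n} v M y = trans (lookup-⊛ y (replicate n cons ⊛ v) (transpose M))
  (cong (λ f → f (lookup (transpose M) y))
    (trans (lookup-⊛ y (replicate n cons) v) (cong (λ f → f (lookup v y)) (lookup-replicate y cons))))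
  where
  cons : Bool → Vec Bool m → Vec Bool (suc m)
  cons = _∷_

column-size-∷ : ∀ {m n} (v : Subset n) (M : Vec (Subset n) m) y →
                ∣ lookup (transpose (v ∷ M)) y ∣ ≡ member v y + ∣ lookup (transpose M) y ∣
column-size-∷ v M y = trans (cong ∣_∣ (column-∷ v M y)) (size-∷ (lookup v y) (lookup (transpose M) y))

column-sum : ∀ {m n} (M : Vec (Subset n) m) y → ∣ lookup (transpose M) y ∣ ≡ ∑[ x < m ] member (lookup M x) y
column-sum []      y = cong ∣_∣ (lookup-replicate y [])
column-sum (v ∷ M) y = trans (column-size-∷ v M y) (cong (member v y +_) (column-sum M y))

-- Rectangular, and with the set U of covered columns prescribed, so that deleting a row and its
-- matched column stays within the notion.
IsMatching : ∀ {m n} → Vec (Subset n) m → Subset n → Vec (Subset n) m → Set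
IsMatching H U M =
  (∀ x → lookup M x ⊆ lookup H x) ×
  (∀ x → ∣ lookup M x ∣ ≡ 1) ×
  (∀ y → ∣ lookup (transpose M) y ∣ ≡ member U y)

isMatching? : ∀ {m n} (H : Vec (Subset n) m) U → Decidable (IsMatching H U)
isMatching? H U M =
  Fin.all? (λ x → lookup M x ⊆? lookup H x) ×-dec
  Fin.all? (λ x → ∣ lookup M x ∣ ≟ 1) ×-dec
  Fin.all? (λ y → ∣ lookup (transpose M) y ∣ ≟ member U y)

rowVectors : ∀ m n → List (Vec (Subset n) m)
rowVectors m n = allVecs (allVecs bits n) m

matchings : ∀ {m n} → Vec (Subset n) m → Subset n → ℕ
matchings {m} {n} H U = length (filter (isMatching? H U) (rowVectors m n))

perfectMatchings≡matchings : ∀ {n} (H : BipartiteGraph n) → perfectMatchings H ≡ matchings H ⊤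
perfectMatchings≡matchings {n} H = cong length
  (filter-≐ (isPerfectMatching? H) (isMatching? H ⊤) ((λ {M} → to {M}) , (λ {M} → from {M})) (allEdgeSets n))
  where
  ⊤≡1 : ∀ y → 1 ≡ member {n} ⊤ y
  ⊤≡1 y = cong indicator (sym (lookup-replicate y true))
  edges : ∀ {m} (M : Vec (Subset n) m) → (∀ x → ∣ lookup M x ∣ ≡ 1) → Vec.sum (Vec.map ∣_∣ M) ≡ m
  edges []      _ = refl
  edges (v ∷ M) rows = cong₂ _+_ (rows zero) (edges M (rows ∘ suc))
  to : ∀ {M} → IsPerfectMatching H M → IsMatching H ⊤ M
  to (M⊆H , _ , rows , columns) = M⊆H , rows , λ y → trans (columns y) (⊤≡1 y)
  from : ∀ {M} → IsMatching H ⊤ M → IsPerfectMatching H M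
  from {M} (M⊆H , rows , columns) = M⊆H , edges M rows , rows , λ y → trans (columns y) (sym (⊤≡1 y))

module _ {m n} (h : Subset n) (H : Vec (Subset n) m) (U : Subset n) where

  private
    extensions : Subset n → ℕ
    extensions v = length (filter (λ M → isMatching? (h ∷ H) U (v ∷ M)) (rowVectors m n))

    extensions-none : ∀ v → (∀ M → IsMatching (h ∷ H) U (v ∷ M) → ⊥) → extensions v ≡ 0
    extensions-none v none = cong length (filter-none _ (All.universal none (rowVectors m n)))

    extensions-singleton : ∀ y → extensions ⁅ y ⁆ ≡ member h y * member U y * matchings H (U - y)
    extensions-singleton y with lookup h y in hy | lookup U y in Uy
    ... | false | _ = extensions-none ⁅ y ⁆ λ M (M⊆H , _) →
      contradiction (trans (sym hy) ([]=⇒lookup (M⊆H zero (x∈⁅x⁆ y)))) λ ()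
    ... | true | false = extensions-none ⁅ y ⁆ λ M (_ , _ , columns) →
      contradiction (trans (sym (trans (column-size-∷ ⁅ y ⁆ M y) (cong (λ b → indicator b + ∣ lookup (transpose M) y ∣) ([]=⇒lookup (x∈⁅x⁆ y)))))
                           (trans (columns y) (cong indicator Uy))) λ ()
    ... | true | true = trans
      (cong length (filter-≐ _ (isMatching? H (U - y)) ((λ {M} → to {M}) , (λ {M} → from {M})) (rowVectors m n)))
      (sym (+-identityʳ _))
      where
      to : ∀ {M} → IsMatching (h ∷ H) U (⁅ y ⁆ ∷ M) → IsMatching H (U - y) M
      to {M} (M⊆H , rows , columns) = M⊆H ∘ suc , rows ∘ suc , λ z →
        +-cancelˡ-≡ (member ⁅ y ⁆ z) _ _
          (trans (sym (column-size-∷ ⁅ y ⁆ M z)) (trans (columns z) (sym (member-remove U y z Uy))))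
      from : ∀ {M} → IsMatching H (U - y) M → IsMatching (h ∷ H) U (⁅ y ⁆ ∷ M)
      from {M} (M⊆H , rows , columns) =
        (λ { zero x∈⁅y⁆ → subst (_∈ h) (sym (x∈⁅y⁆⇒x≡y y x∈⁅y⁆)) (lookup⇒[]= y h hy)
           ; (suc x) → M⊆H x }) ,
        (λ { zero → ∣⁅x⁆∣≡1 y ; (suc x) → rows x }) ,
        λ z → trans (column-size-∷ ⁅ y ⁆ M z)
                (trans (cong (member ⁅ y ⁆ z +_) (columns z)) (member-remove U y z Uy))

  -- The expansion of a permanent along its first row.
  matchings-∷ : matchings (h ∷ H) U ≡ ∑[ y < n ] (member h y * member U y * matchings H (U - y))
  matchings-∷ = begin-equality
    matchings (h ∷ H) U
      ≡⟨ length-filter-cartesianProductWith (isMatching? (h ∷ H) U) _∷_ (allVecs bits n) (rowVectors m n) ⟩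
    sum (map extensions (allVecs bits n))
      ≡⟨ sum-singleton-subsets n extensions (λ v ∣v∣≢1 → extensions-none v λ M (_ , rows , _) → ∣v∣≢1 (rows zero)) ⟩
    ∑[ y < n ] extensions ⁅ y ⁆
      ≡⟨ sum-cong-≗ extensions-singleton ⟩
    ∑[ y < n ] (member h y * member U y * matchings H (U - y)) ∎

-- Sums over subsets and products with one factor changed

sum-mono-≤ : ∀ {n} {f g : Fin n → ℕ} → (∀ i → f i ≤ g i) → ∑[ i < n ] f i ≤ ∑[ i < n ] g i
sum-mono-≤ {zero}  f≤g = z≤n
sum-mono-≤ {suc n} f≤g = +-mono-≤ (f≤g zero) (sum-mono-≤ (f≤g ∘ suc))

term≤sum : ∀ {n} (f : Fin n → ℕ) i → f i ≤ ∑[ j < n ] f j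
term≤sum f zero    = m≤m+n (f zero) _
term≤sum f (suc i) = ≤-trans (term≤sum (f ∘ suc) i) (m≤n+m _ (f zero))

-- R is the product over the indices other than c. Being common to all such g, it can be pulled out
-- of the sum over columns when a row of component c is expanded.
product-update : ∀ {N} (c : Fin N) (f : Fin N → ℕ) →
  ∃[ R ] ∀ g → (∀ d → d ≢ c → g d ≡ f d) → product g ≡ g c * R
product-update {suc N} c f = product (f ∘ punchIn c) , λ g g≡f →
  trans (Product.sum-remove {i = c} g)
        (cong (g c *_) (Product.sum-cong-≗ λ d → g≡f (punchIn c d) (Fin.punchInᵢ≢i c d)))

δ : ∀ {N} → Fin N → Fin N → ℕ
δ i j = indicator (does (i Fin.≟ j))

δ-refl : ∀ {N} (i : Fin N) → δ i i ≡ 1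
δ-refl i with i Fin.≟ i
... | yes _  = refl
... | no i≢i = contradiction refl i≢i

δ-≢ : ∀ {N} {i j : Fin N} → i ≢ j → δ i j ≡ 0
δ-≢ {i = i} {j} i≢j with i Fin.≟ j
... | yes i≡j = contradiction i≡j i≢j
... | no _    = refl

indicator≤1 : ∀ b → indicator b ≤ 1
indicator≤1 true  = ≤-refl
indicator≤1 false = z≤n

sum-at-singleton : ∀ {n} y (g : Fin n → ℕ) → ∑[ z < n ] (member ⁅ y ⁆ z * g z) ≡ g y
sum-at-singleton {suc n} zero g = begin-equality
  g zero + 0 + ∑[ z < n ] (member ∅ z * g (suc z))
    ≡⟨ cong₂ _+_ (+-identityʳ (g zero))
         (trans (sum-cong-≗ λ z → cong (λ b → indicator b * g (suc z)) (lookup-replicate z false)) (sum-replicate-zero n)) ⟩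
  g zero + 0  ≡⟨ +-identityʳ (g zero) ⟩
  g zero      ∎
sum-at-singleton (suc y) g = sum-at-singleton y (g ∘ suc)

sum-remove-member : ∀ {n} (U : Subset n) y (g : Fin n → ℕ) → lookup U y ≡ true →
  ∑[ z < n ] (member U z * g z) ≡ g y + ∑[ z < n ] (member (U - y) z * g z)
sum-remove-member {n} U y g y∈U = begin-equality
  ∑[ z < n ] (member U z * g z)
    ≡⟨ sum-cong-≗ (λ z → trans (cong (_* g z) (sym (member-remove U y z y∈U))) (*-distribʳ-+ (g z) (member ⁅ y ⁆ z) _)) ⟩
  ∑[ z < n ] (member ⁅ y ⁆ z * g z + member (U - y) z * g z)
    ≡⟨ ∑-distrib-+ (λ z → member ⁅ y ⁆ z * g z) (λ z → member (U - y) z * g z) ⟩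
  ∑[ z < n ] (member ⁅ y ⁆ z * g z) + ∑[ z < n ] (member (U - y) z * g z)
    ≡⟨ cong (_+ ∑[ z < n ] (member (U - y) z * g z)) (sum-at-singleton y g) ⟩
  g y + ∑[ z < n ] (member (U - y) z * g z) ∎

-- The number of perfect matchings of a complete bipartite graph on r + r
-- vertices from which a matching of size p has been deleted.
weight : ℕ → ℕ → ℕ
weight r p = avoiding p (r ∸ p)

weight-+ : ∀ p i → weight (p + i) p ≡ avoiding p i
weight-+ p i = cong (avoiding p) (m+n∸m≡n p i)

-- Expansion along a row that has lost no edge: i + 1 columns are equally intact, while each of the
-- p others takes its deleted edge away with it. At p = 0 the value of `p ∸ 1` is multiplied by 0.
weight-expand : ∀ p i → suc i * weight (p + i) p + p * weight (p + i) (p ∸ 1) ≡ weight (suc (p + i)) p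
weight-expand zero    i = +-identityʳ (suc i * i !)
weight-expand (suc p) i = begin-equality
  suc i * weight (suc p + i) (suc p) + suc p * weight (suc (p + i)) p
    ≡⟨ cong₂ (λ u v → suc i * u + suc p * v) (weight-+ (suc p) i) (weight-suc p i) ⟩
  suc i * avoiding (suc p) i + suc p * avoiding p (suc i)
    ≡⟨ +-comm (suc i * avoiding (suc p) i) _ ⟩
  suc p * avoiding p (suc i) + suc i * avoiding (suc p) i
    ≡⟨ avoiding-expand p i ⟨
  avoiding (suc p) (suc i)
    ≡⟨ weight-suc (suc p) i ⟨
  weight (suc (suc p + i)) (suc p) ∎
  where
  weight-suc : ∀ p i → weight (suc (p + i)) p ≡ avoiding p (suc i)
  weight-suc p i = trans (cong (λ r → weight r p) (sym (+-suc p i))) (weight-+ p (suc i))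

-- The matchings either avoid one further edge or contain it, and in the second case its two ends
-- are removed.
weight-difference : ∀ p i → weight (suc (p + i)) p ≡ weight (suc (p + i)) (suc p) + weight (p + i) p
weight-difference p i = begin-equality
  weight (suc (p + i)) p                             ≡⟨ cong (λ r → weight r p) (+-suc p i) ⟨
  weight (p + suc i) p                               ≡⟨ weight-+ p (suc i) ⟩
  avoiding p (suc i)                                 ≡⟨ avoiding-difference p i ⟩
  avoiding (suc p) i + avoiding p i                  ≡⟨ cong₂ _+_ (weight-+ (suc p) i) (weight-+ p i) ⟨
  weight (suc (p + i)) (suc p) + weight (p + i) p    ∎

-- The expansion along one row of the matching count of a single component:
-- u marks the free columns, d those of the component, h the neighbours of the
-- row and B its non-neighbours in the component, t the columns with a
-- non-neighbour in a later row.
row-expansion : ∀ {n} (u d h B t : Fin n → ℕ) r p →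
  (∀ y → h y + B y ≡ d y) → (∀ y → B y + t y ≤ 1) → ∑[ y < n ] (u y * B y) ≤ 1 →
  ∑[ y < n ] (u y * d y) ≡ suc r → ∑[ y < n ] (u y * (d y * t y)) ≡ p → p ≤ r →
  ∑[ y < n ] (h y * u y * weight r (p ∸ t y)) ≡ weight (suc r) (∑[ y < n ] (u y * B y) + p)
row-expansion {n} u d h B t r p h+B≡d B+t≤1 β≤1 ud≡ udt≡ p≤r
  with i , refl ← m≤n⇒∃[o]m+o≡n p≤r = conclude β≤1 X+βW
  where
  W  = weight r p
  W₁ = weight r (p ∸ 1)
  G : Fin n → ℕ
  G y = weight r (p ∸ t y)
  X = ∑[ y < n ] (h y * u y * G y)
  β = ∑[ y < n ] (u y * B y)

  split : ∀ y → h y * u y * G y + u y * B y * W ≡ u y * d y * G y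
  split y = begin-equality
    h y * u y * G y + u y * B y * W      ≡⟨ cong (h y * u y * G y +_) (BW≡BG (B y) (t y) (B+t≤1 y)) ⟩
    h y * u y * G y + u y * B y * G y    ≡⟨ ring (h y) (u y) (B y) (G y) ⟩
    u y * (h y + B y) * G y              ≡⟨ cong (λ v → u y * v * G y) (h+B≡d y) ⟩
    u y * d y * G y                      ∎
    where
    ring : ∀ h u B G → h * u * G + u * B * G ≡ u * (h + B) * G
    ring = solve-∀
    -- A non-neighbour of the current row has no non-neighbour among the later rows, so its weight
    -- is W.
    BW≡BG : ∀ B t → B + t ≤ 1 → u y * B * W ≡ u y * B * weight r (p ∸ t)
    BW≡BG zero    t _ = trans (cong (_* W) (*-zeroʳ (u y))) (sym (cong (_* weight r (p ∸ t)) (*-zeroʳ (u y))))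
    BW≡BG (suc B) zero    _ = refl
    BW≡BG (suc B) (suc t) (s≤s le) = contradiction (≤-trans (m≤n+m (suc t) B) le) λ ()

  -- Adding the β non-neighbours back gives the expansion of a row without any. Of the r + 1 free
  -- columns, p have weight W₁ and the others W; p * W is added to both sides to avoid the
  -- subtraction r + 1 - p.
  X+βW : X + β * W ≡ weight (suc r) p
  X+βW = +-cancelʳ-≡ (p * W) _ _ (begin-equality
    X + β * W + p * W
      ≡⟨ cong (λ v → X + v + p * W) (*-distribʳ-sum W (λ y → u y * B y)) ⟩
    X + ∑[ y < n ] (u y * B y * W) + p * W
      ≡⟨ cong (_+ p * W) (∑-distrib-+ (λ y → h y * u y * G y) (λ y → u y * B y * W)) ⟨
    ∑[ y < n ] (h y * u y * G y + u y * B y * W) + p * W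
      ≡⟨ cong₂ _+_ (sum-cong-≗ split) (cong (_* W) (sym udt≡)) ⟩
    ∑[ y < n ] (u y * d y * G y) + ∑[ y < n ] (u y * (d y * t y)) * W
      ≡⟨ cong (∑[ y < n ] (u y * d y * G y) +_) (*-distribʳ-sum W (λ y → u y * (d y * t y))) ⟩
    ∑[ y < n ] (u y * d y * G y) + ∑[ y < n ] (u y * (d y * t y) * W)
      ≡⟨ ∑-distrib-+ (λ y → u y * d y * G y) (λ y → u y * (d y * t y) * W) ⟨
    ∑[ y < n ] (u y * d y * G y + u y * (d y * t y) * W)
      ≡⟨ sum-cong-≗ (λ y → exchange (u y) (d y) (t y) (≤-trans (m≤n+m (t y) (B y)) (B+t≤1 y))) ⟩
    ∑[ y < n ] (u y * d y * W + u y * (d y * t y) * W₁)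
      ≡⟨ ∑-distrib-+ (λ y → u y * d y * W) (λ y → u y * (d y * t y) * W₁) ⟩
    ∑[ y < n ] (u y * d y * W) + ∑[ y < n ] (u y * (d y * t y) * W₁)
      ≡⟨ cong₂ _+_ (*-distribʳ-sum W (λ y → u y * d y)) (*-distribʳ-sum W₁ (λ y → u y * (d y * t y))) ⟨
    ∑[ y < n ] (u y * d y) * W + ∑[ y < n ] (u y * (d y * t y)) * W₁
      ≡⟨ cong₂ (λ a b → a * W + b * W₁) ud≡ udt≡ ⟩
    suc (p + i) * W + p * W₁
      ≡⟨ ring p i W W₁ ⟩
    (suc i * W + p * W₁) + p * W
      ≡⟨ cong (_+ p * W) (weight-expand p i) ⟩
    weight (suc r) p + p * W ∎)
    where
    ring : ∀ p i W W₁ → suc (p + i) * W + p * W₁ ≡ (suc i * W + p * W₁) + p * W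
    ring = solve-∀
    exchange : ∀ u d t → t ≤ 1 →
      u * d * weight r (p ∸ t) + u * (d * t) * W ≡ u * d * W + u * (d * t) * W₁
    exchange u d zero       _ = ring₀ u d W W₁
      where
      ring₀ : ∀ u d W W₁ → u * d * W + u * (d * 0) * W ≡ u * d * W + u * (d * 0) * W₁
      ring₀ = solve-∀
    exchange u d (suc zero) _ = ring₁ u d W W₁
      where
      ring₁ : ∀ u d W W₁ → u * d * W₁ + u * (d * 1) * W ≡ u * d * W + u * (d * 1) * W₁
      ring₁ = solve-∀
    exchange u d (suc (suc t)) (s≤s ())

  -- For β = 1 the row has a deleted edge after all, and `weight-difference` takes the term W out
  -- again.
  conclude : ∀ {β} → β ≤ 1 → X + β * W ≡ weight (suc r) p → X ≡ weight (suc r) (β + p)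
  conclude z≤n       eq = trans (sym (+-identityʳ X)) eq
  conclude (s≤s z≤n) eq = +-cancelʳ-≡ W _ _ (begin-equality
    X + W                        ≡⟨ cong (X +_) (+-identityʳ W) ⟨
    X + 1 * W                    ≡⟨ eq ⟩
    weight (suc r) p             ≡⟨ weight-difference p i ⟩
    weight (suc r) (suc p) + W   ∎)

-- Rows and columns are labelled by components, and B marks the non-edges
-- inside a component.
record NearlyComplete {m n N} (H : Vec (Subset n) m) (row : Fin m → Fin N) (column : Fin n → Fin N)
                      (B : Fin m → Fin n → ℕ) : Set where
  field
    complement : ∀ x y → member (lookup H x) y + B x y ≡ δ (column y) (row x)
    row≤1      : ∀ x → ∑[ y < n ] B x y ≤ 1
    column≤1   : ∀ y → ∑[ x < m ] B x y ≤ 1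

rowCount : ∀ {m N} → (Fin m → Fin N) → Fin N → ℕ
rowCount {m} row c = ∑[ x < m ] δ (row x) c

columnCount : ∀ {n N} → Subset n → (Fin n → Fin N) → Fin N → ℕ
columnCount {n} U column c = ∑[ y < n ] (member U y * δ (column y) c)

-- The parameter p of `weight` for component c: its non-edges between the remaining rows and the
-- free columns.
missing : ∀ {m n N} → (Fin m → Fin N) → (Fin m → Fin n → ℕ) → Subset n → Fin N → ℕ
missing {m} {n} row B U c = ∑[ x < m ] (δ (row x) c * ∑[ y < n ] (member U y * B x y))

member-sum≤ : ∀ {n} (U : Subset n) (f : Fin n → ℕ) → ∑[ y < n ] (member U y * f y) ≤ ∑[ y < n ] f y
member-sum≤ U f = sum-mono-≤ λ y → ≤-trans (*-monoˡ-≤ (f y) (indicator≤1 (lookup U y))) (≤-reflexive (*-identityˡ (f y)))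

module _ {m n N} {H : Vec (Subset n) m} {row : Fin m → Fin N} {column : Fin n → Fin N} {B : Fin m → Fin n → ℕ}
         (nearly : NearlyComplete H row column B) where

  open NearlyComplete nearly

  -- If the labels of x and y differ, `complement` forces B x y = 0.
  label-transfer : ∀ x y c → δ (row x) c * B x y ≡ δ (column y) c * B x y
  label-transfer x y c with column y Fin.≟ row x | complement x y
  ... | yes eq | _   = cong (λ d → δ d c * B x y) (sym eq)
  ... | no  _  | h+B rewrite m+n≡0⇒n≡0 (member (lookup H x) y) h+B =
    trans (*-zeroʳ (δ (row x) c)) (sym (*-zeroʳ (δ (column y) c)))

  -- Double counting: in this form deleting a column takes away a single term.
  missing-by-columns : ∀ U c →
    missing row B U c ≡ ∑[ y < n ] (member U y * (δ (column y) c * ∑[ x < m ] B x y))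
  missing-by-columns U c = begin-equality
    ∑[ x < m ] (δ (row x) c * ∑[ y < n ] (member U y * B x y))
      ≡⟨ sum-cong-≗ (λ x → *-distribˡ-sum (δ (row x) c) (λ y → member U y * B x y)) ⟩
    ∑[ x < m ] ∑[ y < n ] (δ (row x) c * (member U y * B x y))
      ≡⟨ ∑-comm (λ x y → δ (row x) c * (member U y * B x y)) ⟩
    ∑[ y < n ] ∑[ x < m ] (δ (row x) c * (member U y * B x y))
      ≡⟨ sum-cong-≗ (λ y → sum-cong-≗ λ x →
           trans (swap (δ (row x) c) (member U y) (B x y)) (cong (member U y *_) (label-transfer x y c))) ⟩
    ∑[ y < n ] ∑[ x < m ] (member U y * (δ (column y) c * B x y))
      ≡⟨ sum-cong-≗ (λ y → sym (trans (cong (member U y *_) (*-distribˡ-sum (δ (column y) c) (λ x → B x y)))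
                                      (*-distribˡ-sum (member U y) (λ x → δ (column y) c * B x y)))) ⟩
    ∑[ y < n ] (member U y * (δ (column y) c * ∑[ x < m ] B x y)) ∎
    where
    swap : ∀ a b c → a * (b * c) ≡ b * (a * c)
    swap = solve-∀

  missing≤rowCount : ∀ U c → missing row B U c ≤ rowCount row c
  missing≤rowCount U c = sum-mono-≤ λ x →
    ≤-trans (*-monoʳ-≤ (δ (row x) c) (≤-trans (member-sum≤ U (B x)) (row≤1 x))) (≤-reflexive (*-identityʳ _))

  missing-remove : ∀ U y c → lookup U y ≡ true →
    missing row B U c ≡ δ (column y) c * ∑[ x < m ] B x y + missing row B (U - y) c
  missing-remove U y c y∈U = begin-equality
    missing row B U c
      ≡⟨ missing-by-columns U c ⟩
    ∑[ z < n ] (member U z * (δ (column z) c * ∑[ x < m ] B x z))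
      ≡⟨ sum-remove-member U y (λ z → δ (column z) c * ∑[ x < m ] B x z) y∈U ⟩
    δ (column y) c * ∑[ x < m ] B x y + ∑[ z < n ] (member (U - y) z * (δ (column z) c * ∑[ x < m ] B x z))
      ≡⟨ cong (δ (column y) c * ∑[ x < m ] B x y +_) (missing-by-columns (U - y) c) ⟨
    δ (column y) c * ∑[ x < m ] B x y + missing row B (U - y) c ∎

nearlyComplete-tail : ∀ {m n N} {h : Subset n} {H : Vec (Subset n) m} {row : Fin (suc m) → Fin N} {column B} →
  NearlyComplete (h ∷ H) row column B → NearlyComplete H (row ∘ suc) column (B ∘ suc)
nearlyComplete-tail {B = B} nearly = record
  { complement = complement ∘ suc
  ; row≤1      = row≤1 ∘ suc
  ; column≤1   = λ y → ≤-trans (m≤n+m _ (B zero y)) (column≤1 y)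
  }
  where open NearlyComplete nearly

-- Induction on the rows; the invariant is that each component has as many remaining rows as free
-- columns. A neighbour of the first row shares its label c₀, so removing both changes only the
-- factor at c₀, which `row-expansion` evaluates, while R collects the others.
matchings-product : ∀ {m n N} (H : Vec (Subset n) m) (row : Fin m → Fin N) (column : Fin n → Fin N) B U →
  NearlyComplete H row column B → (∀ c → rowCount row c ≡ columnCount U column c) →
  matchings H U ≡ product (λ c → weight (rowCount row c) (missing row B U c))
matchings-product {n = n} {N} [] row column B U nearly balanced = begin-equality
  matchings [] U                ≡⟨ cong length (filter-accept (isMatching? [] U) {[]} {[]} ((λ ()) , (λ ()) , columns)) ⟩
  1                             ≡⟨ Product.sum-replicate-zero N ⟨
  product (λ (_ : Fin N) → 1)   ∎
  where
  -- A free column would be counted under its own label, where there are no rows; so U is empty.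
  columns : ∀ y → ∣ lookup (transpose {n = n} []) y ∣ ≡ member U y
  columns y = trans (column-sum [] y) (sym (n≤0⇒n≡0 (≤-trans
    (≤-reflexive (sym (trans (cong (member U y *_) (δ-refl (column y))) (*-identityʳ _))))
    (≤-trans (term≤sum (λ z → member U z * δ (column z) (column y)) y)
             (≤-reflexive (sym (balanced (column y))))))))
matchings-product {suc m} {n} {N} (h ∷ H) row column B U nearly balanced = begin-equality
  matchings (h ∷ H) U
    ≡⟨ matchings-∷ h H U ⟩
  ∑[ y < n ] (member h y * member U y * matchings H (U - y))
    ≡⟨ sum-cong-≗ term ⟩
  ∑[ y < n ] (member h y * member U y * weight r (p ∸ t y) * R)
    ≡⟨ *-distribʳ-sum R (λ y → member h y * member U y * weight r (p ∸ t y)) ⟨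
  ∑[ y < n ] (member h y * member U y * weight r (p ∸ t y)) * R
    ≡⟨ cong (_* R) (row-expansion (member U) (λ y → δ (column y) c₀) (member h) (B zero) t r p
         (complement zero) column≤1 (≤-trans (member-sum≤ U (B zero)) (row≤1 zero))
         (trans (sym (balanced c₀)) rows₀) (sym (missing-by-columns nearly′ U c₀)) (missing≤rowCount nearly′ U c₀)) ⟩
  weight (suc r) (β + p) * R
    ≡⟨ cong (_* R) (cong₂ weight rows₀ missing₀) ⟨
  f c₀ * R
    ≡⟨ update f (λ _ _ → refl) ⟨
  product f ∎
  where
  open NearlyComplete nearly
  nearly′ = nearlyComplete-tail nearly
  c₀ = row zero
  row′ = row ∘ suc
  B′ = B ∘ suc
  r = rowCount row′ c₀
  p = missing row′ B′ U c₀
  β = ∑[ y < n ] (member U y * B zero y)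
  t : Fin n → ℕ
  t y = ∑[ x < m ] B′ x y
  f : Fin N → ℕ
  f c = weight (rowCount row c) (missing row B U c)
  R = proj₁ (product-update c₀ f)
  update = proj₂ (product-update c₀ f)

  rows₀ : rowCount row c₀ ≡ suc r
  rows₀ = cong (_+ r) (δ-refl c₀)

  missing₀ : missing row B U c₀ ≡ β + p
  missing₀ = cong (_+ p) (trans (cong (_* β) (δ-refl c₀)) (*-identityˡ β))

  rest : ∀ y → lookup U y ≡ true → column y ≡ c₀ → ∀ c → c ≢ c₀ →
         weight (rowCount row′ c) (missing row′ B′ (U - y) c) ≡ f c
  rest y y∈U col≡c₀ c c≢c₀ = cong₂ weight
    (cong (_+ rowCount row′ c) (sym c₀≢c))
    (trans
      (sym (trans (missing-remove nearly′ U y c y∈U)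
        (cong (λ d → d * t y + missing row′ B′ (U - y) c) (trans (cong (λ d → δ d c) col≡c₀) c₀≢c))))
      (cong (λ d → d * β + missing row′ B′ U c) (sym c₀≢c)))
    where
    c₀≢c : δ c₀ c ≡ 0
    c₀≢c = δ-≢ (c≢c₀ ∘ sym)

  induction : ∀ y → lookup U y ≡ true → column y ≡ c₀ → matchings H (U - y) ≡ weight r (p ∸ t y) * R
  induction y y∈U col≡c₀ = begin-equality
    matchings H (U - y)
      ≡⟨ matchings-product H row′ column B′ (U - y) nearly′ balanced′ ⟩
    product (λ c → weight (rowCount row′ c) (missing row′ B′ (U - y) c))
      ≡⟨ update _ (rest y y∈U col≡c₀) ⟩
    weight r (missing row′ B′ (U - y) c₀) * R
      ≡⟨ cong (λ q → weight r q * R) removed ⟩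
    weight r (p ∸ t y) * R ∎
    where
    balanced′ : ∀ c → rowCount row′ c ≡ columnCount (U - y) column c
    balanced′ c = +-cancelˡ-≡ (δ c₀ c) _ _ (begin-equality
      rowCount row c                                      ≡⟨ balanced c ⟩
      columnCount U column c                              ≡⟨ sum-remove-member U y (λ z → δ (column z) c) y∈U ⟩
      δ (column y) c + columnCount (U - y) column c       ≡⟨ cong (λ d → δ d c + columnCount (U - y) column c) col≡c₀ ⟩
      δ c₀ c + columnCount (U - y) column c               ∎)
    removed : missing row′ B′ (U - y) c₀ ≡ p ∸ t y
    removed = begin-equality
      missing row′ B′ (U - y) c₀                    ≡⟨ m+n∸m≡n (t y) _ ⟨
      t y + missing row′ B′ (U - y) c₀ ∸ t y        ≡⟨ cong (λ v → v + missing row′ B′ (U - y) c₀ ∸ t y) δt≡t ⟨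
      δ (column y) c₀ * t y + missing row′ B′ (U - y) c₀ ∸ t y   ≡⟨ cong (_∸ t y) (missing-remove nearly′ U y c₀ y∈U) ⟨
      p ∸ t y                                       ∎
      where
      δt≡t : δ (column y) c₀ * t y ≡ t y
      δt≡t = trans (cong (_* t y) (trans (cong (λ d → δ d c₀) col≡c₀) (δ-refl c₀))) (*-identityˡ (t y))

  adjacent⇒same-label : ∀ y → lookup h y ≡ true → column y ≡ c₀
  adjacent⇒same-label y y∈h with column y Fin.≟ c₀ | complement zero y
  ... | yes eq | _   = eq
  ... | no _   | h+B = contradiction (trans (sym (cong indicator y∈h)) (m+n≡0⇒m≡0 (member h y) h+B)) λ ()

  term : ∀ y → member h y * member U y * matchings H (U - y) ≡ member h y * member U y * weight r (p ∸ t y) * R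
  term y with lookup h y in y∈h | lookup U y in y∈U
  ... | false | _     = refl
  ... | true  | false = refl
  ... | true  | true  = trans (*-identityˡ _)
    (trans (induction y y∈U (adjacent⇒same-label y y∈h)) (cong (_* R) (sym (*-identityˡ (weight r (p ∸ t y))))))

-- The components of H

length-filter-tabulate : ∀ {A : Set} {P : A → Set} (P? : Decidable P) {n} (f : Fin n → A) →
  length (filter P? (tabulate f)) ≡ ∑[ i < n ] indicator (does (P? (f i)))
length-filter-tabulate P? {zero}  f = refl
length-filter-tabulate P? {suc n} f with does (P? (f zero))
... | true  = cong suc (length-filter-tabulate P? (f ∘ suc))
... | false = length-filter-tabulate P? (f ∘ suc)

product-join : ∀ b q {u v} (f : Fin (b + q) → ℕ) → (∀ i → f (i ↑ˡ q) ≡ u) → (∀ j → f (b ↑ʳ j) ≡ v) →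
               product f ≡ u ^ b * v ^ q
product-join zero zero    f f≡u f≡v = refl
product-join zero (suc q) {u} f f≡u f≡v =
  trans (cong₂ _*_ (f≡v zero) (trans (product-join zero q {u} (f ∘ suc) (λ ()) (f≡v ∘ suc)) (+-identityʳ _)))
        (sym (+-identityʳ _))
product-join (suc b) q {u} f f≡u f≡v =
  trans (cong₂ _*_ (f≡u zero) (product-join b q (f ∘ suc) (f≡u ∘ suc) f≡v)) (sym (*-assoc u (u ^ b) _))

δ-sym : ∀ {N} (i j : Fin N) → δ i j ≡ δ j i
δ-sym i j with i Fin.≟ j
... | yes refl = sym (δ-refl i)
... | no i≢j   = sym (δ-≢ (i≢j ∘ sym))

sum-⊤ : ∀ {n} (f : Fin n → ℕ) → ∑[ y < n ] (member ⊤ y * f y) ≡ ∑[ y < n ] f y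
sum-⊤ f = sum-cong-≗ λ y → trans (cong (λ b → indicator b * f y) (lookup-replicate y true)) (*-identityˡ (f y))

module _ {n k b q} (H : BipartiteGraph n) (regular : Regular k H) (components : Components H b (suc k) q k) where

  open Components components

  private
    label : Fin b ⊎ Fin q → Fin (b + q)
    label = join b q

    label-injective : ∀ {c d} → label c ≡ label d → c ≡ d
    label-injective {c} {d} eq =
      trans (sym (Fin.splitAt-join b q c)) (trans (cong (splitAt b) eq) (Fin.splitAt-join b q d))

    row column : Fin n → Fin (b + q)
    row x    = label (component (inX x))
    column y = label (component (inY y))

    excess : Fin b ⊎ Fin q → ℕ
    excess (inj₁ _) = 1
    excess (inj₂ _) = 0

    size : Fin b ⊎ Fin q → ℕ
    size c = excess c + k

    hasSize : ∀ c → HasSize (≡-dec Fin._≟_ Fin._≟_) component c (size c)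
    hasSize (inj₁ i) = size₁ i
    hasSize (inj₂ j) = size₂ j

    δ-label : ∀ c d → indicator (does (≡-dec Fin._≟_ Fin._≟_ c d)) ≡ δ (label c) (label d)
    δ-label c d with ≡-dec Fin._≟_ Fin._≟_ c d
    ... | yes refl = sym (δ-refl (label c))
    ... | no c≢d   = sym (δ-≢ (c≢d ∘ label-injective))

    label-count : ∀ (f : Fin n → Fin b ⊎ Fin q) c {s} →
      length (filter (λ x → ≡-dec Fin._≟_ Fin._≟_ (f x) c) (tabulate id)) ≡ s →
      ∑[ x < n ] δ (label (f x)) (label c) ≡ s
    label-count f c eq = trans
      (sym (trans (length-filter-tabulate (λ x → ≡-dec Fin._≟_ Fin._≟_ (f x) c) id) (sum-cong-≗ λ x → δ-label (f x) c))) eq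

    row-size : ∀ c → rowCount row (label c) ≡ size c
    row-size c = label-count (component ∘ inX) c (proj₁ (hasSize c))

    column-size : ∀ c → ∑[ y < n ] δ (column y) (label c) ≡ size c
    column-size c = label-count (component ∘ inY) c (proj₂ (hasSize c))

    -- The truncated subtraction is exact, because adjacent vertices share a label
    -- (`adjacent≤same`).
    B : Fin n → Fin n → ℕ
    B x y = δ (column y) (row x) ∸ member (lookup H x) y

    adjacent≤same : ∀ x y → member (lookup H x) y ≤ δ (column y) (row x)
    adjacent≤same x y with lookup (lookup H x) y in y∈Hx
    ... | false = z≤n
    ... | true  = ≤-reflexive (sym (trans (cong (λ c → δ (label c) (row x)) same) (δ-refl (row x))))
      where
      same : component (inY y) ≡ component (inX x)
      same = sym (Equivalence.from (connected (inX x) (inY y)) (lookup⇒[]= y (lookup H x) y∈Hx ◅ Star.ε))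

    complement : ∀ x y → member (lookup H x) y + B x y ≡ δ (column y) (row x)
    complement x y = m+[n∸m]≡n (adjacent≤same x y)

    -- The component has `excess` + k columns, of which regularity makes k adjacent to x. Thus the
    -- non-edges of a component of size k + 1 form a perfect matching, whichever one it is.
    row-excess : ∀ x → ∑[ y < n ] B x y ≡ excess (component (inX x))
    row-excess x = +-cancelʳ-≡ k _ _ (begin-equality
      ∑[ y < n ] B x y + k                           ≡⟨ +-comm _ k ⟩
      k + ∑[ y < n ] B x y                           ≡⟨ cong (_+ ∑[ y < n ] B x y) (trans (sym (regular (inX x))) (size-sum (lookup H x))) ⟩
      ∑[ y < n ] member (lookup H x) y + ∑[ y < n ] B x y  ≡⟨ ∑-distrib-+ (member (lookup H x)) (B x) ⟨
      ∑[ y < n ] (member (lookup H x) y + B x y)     ≡⟨ sum-cong-≗ (complement x) ⟩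
      ∑[ y < n ] δ (column y) (row x)                ≡⟨ column-size (component (inX x)) ⟩
      size (component (inX x))                       ∎)

    column-excess : ∀ y → ∑[ x < n ] B x y ≡ excess (component (inY y))
    column-excess y = +-cancelʳ-≡ k _ _ (begin-equality
      ∑[ x < n ] B x y + k                           ≡⟨ +-comm _ k ⟩
      k + ∑[ x < n ] B x y                           ≡⟨ cong (_+ ∑[ x < n ] B x y) (trans (sym (regular (inY y))) (column-sum H y)) ⟩
      ∑[ x < n ] member (lookup H x) y + ∑[ x < n ] B x y  ≡⟨ ∑-distrib-+ (λ x → member (lookup H x) y) (λ x → B x y) ⟨
      ∑[ x < n ] (member (lookup H x) y + B x y)     ≡⟨ sum-cong-≗ (λ x → trans (complement x y) (δ-sym (column y) (row x))) ⟩
      rowCount row (column y)                        ≡⟨ row-size (component (inY y)) ⟩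
      size (component (inY y))                       ∎)

    excess≤1 : ∀ c → excess c ≤ 1
    excess≤1 (inj₁ _) = ≤-refl
    excess≤1 (inj₂ _) = z≤n

    nearly : NearlyComplete H row column B
    nearly = record
      { complement = complement
      ; row≤1      = λ x → ≤-trans (≤-reflexive (row-excess x)) (excess≤1 (component (inX x)))
      ; column≤1   = λ y → ≤-trans (≤-reflexive (column-excess y)) (excess≤1 (component (inY y)))
      }

    balanced : ∀ c → rowCount row c ≡ columnCount ⊤ column c
    balanced c = subst (λ c → rowCount row c ≡ columnCount ⊤ column c) (Fin.join-splitAt b q c)
      (trans (row-size (splitAt b c))
        (sym (trans (sum-⊤ (λ y → δ (column y) (label (splitAt b c)))) (column-size (splitAt b c)))))

    missing-size : ∀ c → missing row B ⊤ (label c) ≡ size c * excess c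
    missing-size c = begin-equality
      ∑[ x < n ] (δ (row x) (label c) * ∑[ y < n ] (member ⊤ y * B x y))
        ≡⟨ sum-cong-≗ (λ x → trans (cong (δ (row x) (label c) *_) (trans (sum-⊤ (B x)) (row-excess x))) (same-excess x)) ⟩
      ∑[ x < n ] (δ (row x) (label c) * excess c)
        ≡⟨ *-distribʳ-sum (excess c) (λ x → δ (row x) (label c)) ⟨
      rowCount row (label c) * excess c
        ≡⟨ cong (_* excess c) (row-size c) ⟩
      size c * excess c ∎
      where
      same-excess : ∀ x → δ (row x) (label c) * excess (component (inX x)) ≡ δ (row x) (label c) * excess c
      same-excess x with row x Fin.≟ label c
      ... | yes eq = cong (λ d → 1 * excess d) (label-injective eq)
      ... | no _   = refl

    component-weight : ∀ c → weight (rowCount row (label c)) (missing row B ⊤ (label c)) ≡ weight (size c) (size c * excess c)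
    component-weight c = cong₂ weight (row-size c) (missing-size c)

  -- In a component of size k + 1 each row misses one column, so r = p = k + 1 and the weight is a
  -- derangement number; in one of size k nothing is missing and the weight is k !.
  perfectMatchings-components : perfectMatchings H ≡ derangements (suc k) ^ b * (k !) ^ q
  perfectMatchings-components = begin-equality
    perfectMatchings H        ≡⟨ perfectMatchings≡matchings H ⟩
    matchings H ⊤             ≡⟨ matchings-product H row column B ⊤ nearly balanced ⟩
    product (λ c → weight (rowCount row c) (missing row B ⊤ c))
      ≡⟨ product-join b q _
           (λ i → trans (component-weight (inj₁ i)) (trans (cong (weight (suc k)) (*-identityʳ (suc k))) (cong (avoiding (suc k)) (n∸n≡0 (suc k)))))
           (λ j → trans (component-weight (inj₂ j)) (cong (weight k) (*-zeroʳ k))) ⟩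
    derangements (suc k) ^ b * (k !) ^ q ∎

-- From one component to the whole graph

-- Bernoulli gives (q/(q + 1))^b ≥ 1 - b/(q + 1), which exceeds s/(s + 1) because q is chosen with
-- (s + 1) b < q + 1.
root-slack : ∀ s b → let q = suc (suc s * b) in s * suc q ^ b < suc s * q ^ b
root-slack s b = *-cancelʳ-< (suc q) _ _ (+-cancelʳ-< (suc s * (b * Z)) _ _ (begin-strict
  s * Z * suc q + suc s * (b * Z)                ≡⟨ ring₁ s b Z ⟩
  (s * suc q + suc s * b) * Z                    <⟨ *-monoˡ-< Z {{m^n≢0 (suc q) b}} (≤-trans (n≤1+n _) (≤-reflexive (ring₂ s b))) ⟩
  suc s * suc q * Z                              ≡⟨ ring₃ (suc s) (suc q) Z ⟩
  suc s * (Z * suc q)                            ≤⟨ *-monoʳ-≤ (suc s) (bernoulli-lower q b) ⟩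
  suc s * (Y * suc q + b * Z)                    ≡⟨ ring₄ (suc s) Y (suc q) (b * Z) ⟩
  suc s * Y * suc q + suc s * (b * Z)            ∎))
  where
  q = suc (suc s * b)
  Y = q ^ b
  Z = suc q ^ b
  ring₁ : ∀ s b Z → s * Z * suc (suc (suc s * b)) + suc s * (b * Z) ≡ (s * suc (suc (suc s * b)) + suc s * b) * Z
  ring₁ = solve-∀
  ring₂ : ∀ s b → 2 + (s * suc (suc (suc s * b)) + suc s * b) ≡ suc s * suc (suc (suc s * b))
  ring₂ = solve-∀
  ring₃ : ∀ u v w → u * v * w ≡ u * (w * v)
  ring₃ = solve-∀
  ring₄ : ∀ u v w x → u * (v * w + x) ≡ u * v * w + u * x
  ring₄ = solve-∀

^-comm : ∀ x m n → (x ^ m) ^ n ≡ (x ^ n) ^ m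
^-comm x m n = trans (^-*-assoc x m n) (trans (cong (x ^_) (*-comm m n)) (sym (^-*-assoc x n m)))

factorial-power : ∀ F k b c → F ^ ((b + c) * k + b) ≡ (F ^ suc k) ^ b * (F ^ c) ^ k
factorial-power F k b c = begin-equality
  F ^ ((b + c) * k + b)          ≡⟨ cong (F ^_) (ring k b c) ⟩
  F ^ (suc k * b + c * k)        ≡⟨ ^-distribˡ-+-* F (suc k * b) (c * k) ⟩
  F ^ (suc k * b) * F ^ (c * k)  ≡⟨ cong₂ _*_ (^-*-assoc F (suc k) b) (^-*-assoc F c k) ⟨
  (F ^ suc k) ^ b * (F ^ c) ^ k  ∎
  where
  ring : ∀ k b c → (b + c) * k + b ≡ suc k * b + c * k
  ring = solve-∀

product-power : ∀ q D C k b → (q ^ b * (D ^ b * C)) ^ k ≡ ((q * D) ^ k) ^ b * C ^ k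
product-power q D C k b = begin-equality
  (q ^ b * (D ^ b * C)) ^ k      ≡⟨ cong (_^ k) (trans (sym (*-assoc (q ^ b) (D ^ b) C)) (cong (_* C) (sym (^-distribʳ-* q D b)))) ⟩
  ((q * D) ^ b * C) ^ k          ≡⟨ ^-distribʳ-* ((q * D) ^ b) C k ⟩
  ((q * D) ^ b) ^ k * C ^ k      ≡⟨ cong (_* C ^ k) (^-comm (q * D) b k) ⟩
  ((q * D) ^ k) ^ b * C ^ k      ∎

-- The c complete components contribute (F^c)^k on both sides, which leaves the b-th power of the
-- estimate for one component of size k + 1.
power-lower : ∀ q r F D k b c → F ^ suc k * q ^ k ≤ (r * D) ^ k →
  F ^ ((b + c) * k + b) * (q ^ b) ^ k ≤ (r ^ b * (D ^ b * F ^ c)) ^ k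
power-lower q r F D k b c le = begin
  F ^ ((b + c) * k + b) * (q ^ b) ^ k            ≡⟨ cong₂ _*_ (factorial-power F k b c) (^-comm q b k) ⟩
  (F ^ suc k) ^ b * (F ^ c) ^ k * (q ^ k) ^ b    ≡⟨ ring ((F ^ suc k) ^ b) ((F ^ c) ^ k) ((q ^ k) ^ b) ⟩
  (F ^ suc k) ^ b * (q ^ k) ^ b * (F ^ c) ^ k    ≡⟨ cong (_* (F ^ c) ^ k) (^-distribʳ-* (F ^ suc k) (q ^ k) b) ⟨
  (F ^ suc k * q ^ k) ^ b * (F ^ c) ^ k          ≤⟨ *-monoˡ-≤ ((F ^ c) ^ k) (^-monoˡ-≤ b le) ⟩
  ((r * D) ^ k) ^ b * (F ^ c) ^ k                ≡⟨ product-power r D (F ^ c) k b ⟨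
  (r ^ b * (D ^ b * F ^ c)) ^ k                  ∎
  where
  ring : ∀ u v w → u * v * w ≡ u * w * v
  ring = solve-∀

power-upper : ∀ q r F D k b c → (q * D) ^ k ≤ r ^ k * F ^ suc k →
  (q ^ b * (D ^ b * F ^ c)) ^ k ≤ (r ^ b) ^ k * F ^ ((b + c) * k + b)
power-upper q r F D k b c le = begin
  (q ^ b * (D ^ b * F ^ c)) ^ k                  ≡⟨ product-power q D (F ^ c) k b ⟩
  ((q * D) ^ k) ^ b * (F ^ c) ^ k                ≤⟨ *-monoˡ-≤ ((F ^ c) ^ k) (^-monoˡ-≤ b le) ⟩
  (r ^ k * F ^ suc k) ^ b * (F ^ c) ^ k          ≡⟨ cong (_* (F ^ c) ^ k) (^-distribʳ-* (r ^ k) (F ^ suc k) b) ⟩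
  (r ^ k) ^ b * (F ^ suc k) ^ b * (F ^ c) ^ k    ≡⟨ *-assoc ((r ^ k) ^ b) ((F ^ suc k) ^ b) ((F ^ c) ^ k) ⟩
  (r ^ k) ^ b * ((F ^ suc k) ^ b * (F ^ c) ^ k)  ≡⟨ cong₂ _*_ (^-comm r b k) (factorial-power F k b c) ⟨
  (r ^ b) ^ k * F ^ ((b + c) * k + b)            ∎

derangements≢0 : ∀ k .{{_ : NonZero k}} → NonZero (derangements (suc k))
derangements≢0 k = m*n≢0⇒m≢0 (derangements (suc k)) {{>-nonZero (≤-trans (>-nonZero⁻¹ (k ! * (k * k ^ k))) (derangements-lower k))}}
  where
  instance
    kᵏ⁺¹≢0 : NonZero (k * k ^ k)
    kᵏ⁺¹≢0 = m*n≢0 k (k ^ k) {{it}} {{m^n≢0 k k}}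
    k!kᵏ⁺¹≢0 : NonZero (k ! * (k * k ^ k))
    k!kᵏ⁺¹≢0 = m*n≢0 (k !) (k * k ^ k) {{k !≢0}}

theorem3 : (a b : ℕ) → b ≤ a →
    (ε : ℚ) → 0ℚ ℚ.< ε →
    ∃[ K ] ((k : ℕ) .{{_ : NonZero k}} → K ≤ k → b < k →
    (n : ℕ) → n ≡ a * k + b →
    (H : BipartiteGraph n) → Regular k H →
    Components H b (suc k) (a ∸ b) k →
    ∣ matchingRatio k H - 1ℚ ∣< ε)
theorem3 a b b≤a ε 0<ε = K , near-one
  where
  c s q K : ℕ
  c = a ∸ b
  -- 1/s < ε; then q makes ((q + 1)/q)^b less than (s + 1)/s. So K depends only on b and ε.
  s = suc (proj₁ (unit-fraction-below ε 0<ε))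
  q = suc (suc s * b)
  K = proj₁ (derangement-asymptotics q)

  near-one : (k : ℕ) .{{_ : NonZero k}} → K ≤ k → b < k → (n : ℕ) → n ≡ a * k + b →
             (H : BipartiteGraph n) → Regular k H → Components H b (suc k) c k → ∣ matchingRatio k H - 1ℚ ∣< ε
  near-one k K≤k _ n n≡ak+b H regular components =
    matchingRatio-near-one k H s (q ^ b) (suc q ^ b) (root-slack s b)
      (subst₂ (λ M n → (k !) ^ n * (q ^ b) ^ k ≤ (suc q ^ b * M) ^ k) (sym M≡) (sym n≡)
        (power-lower q (suc q) (k !) D k b c (proj₁ asymptotics)))
      (subst₂ (λ M n → (q ^ b * M) ^ k ≤ (suc q ^ b) ^ k * (k !) ^ n) (sym M≡) (sym n≡)
        (power-upper q (suc q) (k !) D k b c (proj₂ asymptotics)))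
      (proj₂ (unit-fraction-below ε 0<ε))
    where
    D = derangements (suc k)
    asymptotics = proj₂ (derangement-asymptotics q) k K≤k
    M≡ : perfectMatchings H ≡ D ^ b * (k !) ^ c
    M≡ = perfectMatchings-components H regular components
    n≡ : n ≡ (b + c) * k + b
    n≡ = trans n≡ak+b (cong (λ a → a * k + b) (sym (m+[n∸m]≡n b≤a)))
    instance
      M≢0 : NonZero (perfectMatchings H)
      M≢0 = subst NonZero (sym M≡) (m*n≢0 _ _ {{m^n≢0 D b {{derangements≢0 k}}}} {{m^n≢0 (k !) c {{k !≢0}}}})
      qᵇ≢0 : NonZero (q ^ b)
      qᵇ≢0 = m^n≢0 q b
      1+qᵇ≢0 : NonZero (suc q ^ b)
      1+qᵇ≢0 = m^n≢0 (suc q) b
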